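{- Let $\phi>0$ be a constant, let $\epsilon>0$ and let $M$ be a positive integer. When allocated $\left\lceil \frac{1+\phi}{\epsilon}\right\rceil$ counters, the algorithm FAST$(M,\epsilon,\phi)$ operates in constant time (each Add and each Query operation takes $O(1)$ time) and solves the $(\epsilon,M)$-Volume Estimation problem: after processing any $(\mathcal U,M)$-weighted stream of length $N$, for every $x\in\mathcal U$, the value $\widehat{v_x}$ returned by Query$(x)$ satisfies $$v_x\le \widehat{v_x}\le v_x+N\cdot M\cdot\epsilon .$$
   Context: Streams. Given a set $\mathcal U$ (the universe of ids) and a positive integer $M$, a $(\mathcal U,M)$-weighted stream of length $N$ is a sequence $\langle p_1,\dots,p_N\rangle$ with $p_i=(d_i,w_i)\in\mathcal U\times\{1,\dots,M\}$; $d_i$ is the id and $w_i$ the weight. The volume of $x\in\mathcal U$ is $v_x=\sum_{i:\,d_i=x}w_i$. Processing the stream means calling Add$(d_i,w_i)$ for $i=1,\dots,N$ in order. Algorithm FAST$(M,\epsilon,\phi)$. Let $s=\lfloor M\phi/2+1\rfloor$ and $\mathfrak C=\lceil (1+\phi)/\epsilon\rceil$. The state is a set $C\subseteq\mathcal U$ of items with allocated counters and non-negative integers $c_x,r_x$ for $x\in\mathcal U$. Initially $C=\emptyset$ and $c_x=r_x=0$ for all $x$. Add$(x,w)$: if $x\in C$ or $|C|<\mathfrak C$, then set $c_x\gets c_x+\lfloor (r_x+w)/s\rfloor$ and $r_x\gets (r_x+w)\bmod s$ (both right-hand sides using the old $r_x$), and $C\gets C\cup\{x\}$. Otherwise, choose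 an arbitrary $m\in\arg\min_{y\in C}c_y$, set $c_x\gets c_m+\lfloor (s-1+w)/s\rfloor$, $r_x\gets (s-1+w)\bmod s$, and $C\gets (C\setminus\{m\})\cup\{x\}$. Query$(x)$: if $x\in C$ or $|C|<\mathfrak C$, return $r_x+s\cdot c_x$; otherwise return $s-1+s\cdot\min_{y\in C}c_y$. Data structure (SOS) and cost model. The items of $C$ are kept in groups according to the value $c_x$; the nonempty groups form a linked list ordered by increasing $c$-value; inside a group the items are unordered, and each item's node stores its remainder $r_x$. A separate hash table maps each id in $C$ to its node. Hash table accesses, arithmetic operations, moving from one group to an adjacent one, and inserting/removing an item from a group each cost $O(1)$. -}

module Defs where

open import Algebra.Bundles using (CommutativeRing)
open import Algebra.Structures using (IsCommutativeRing)
import Algebra.Definitions.RawMonoid as RawMonoidDefinitions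
import Algebra.Properties.Ring as RingProperties
open import Data.Bool.Base using (if_then_else_)
open import Data.Fin.Base using (Fin)
open import Data.Integer.Base as ℤ using (ℤ; +_; -[1+_])
open import Data.List.Base using (List; []; _∷_; _++_; length; map; concatMap; filter; foldr; sum; lookup; removeAt)
open import Data.List.NonEmpty.Base as List⁺ using (List⁺; _∷_)
open import Data.List.Relation.Binary.Permutation.Propositional using (_↭_)
open import Data.List.Relation.Unary.All using (All)
open import Data.List.Relation.Unary.Any using (any?; index)
open import Data.List.Relation.Unary.Linked using (Linked)
import Data.List.Membership.Propositional as Membership
import Data.List.Membership.DecPropositional as DecMembership
open import Data.Maybe.Base as Maybe using (Maybe; just; nothing)
open import Data.Nat.Base as ℕ using (ℕ; zero; suc; NonZero; _∸_; _⊓_; _/_; _%_)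
open import Data.Nat.Properties using (_<?_; <-cmp)
open import Data.Product.Base using (∃; _×_; _,_; proj₁; proj₂)
open import Data.Sum.Base using (_⊎_; inj₁; inj₂)
open import Data.Unit.Base using (tt)
open import Data.Vec.Base using (Vec; []; _∷_; toList)
open import Function.Base using (_on_)
open import Level using (Level; _⊔_) renaming (suc to lsuc)
open import Relation.Binary.Core using (Rel)
open import Relation.Binary.Definitions using (DecidableEquality; tri<; tri≈; tri>)
open import Relation.Binary.PropositionalEquality.Core using (_≡_)
open import Relation.Binary.Structures using (IsTotalOrder)
import Relation.Binary.Construct.NonStrictToStrict as NonStrictToStrict
open import Relation.Nullary using (¬_; Dec; yes; no; does; contradiction)
open import Relation.Nullary.Decidable using (_⊎-dec_; ¬?)

private
  variable
    a b u : Level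

-- The inverse is total, with an unspecified value at 0.
record OrderedField c ℓ₁ ℓ₂ : Set (lsuc (c ⊔ ℓ₁ ⊔ ℓ₂)) where
  infix  8 _⁻¹
  infix  8 -_
  infixl 7 _*_
  infixl 6 _+_
  infix  4 _≈_ _≤_
  field
    Carrier           : Set c
    _≈_               : Rel Carrier ℓ₁
    _≤_               : Rel Carrier ℓ₂
    _+_ _*_           : Carrier → Carrier → Carrier
    -_ _⁻¹            : Carrier → Carrier
    0# 1#             : Carrier
    isCommutativeRing : IsCommutativeRing _≈_ _+_ _*_ -_ 0# 1#
    isTotalOrder      : IsTotalOrder _≈_ _≤_
    0≉1               : ¬ (0# ≈ 1#)
    ⁻¹-cong           : ∀ {x y} → x ≈ y → x ⁻¹ ≈ y ⁻¹
    *-inverseʳ        : ∀ {x} → ¬ (x ≈ 0#) → x * x ⁻¹ ≈ 1#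
    +-monoˡ-≤         : ∀ {x y} z → x ≤ y → x + z ≤ y + z
    *-nonneg          : ∀ {x y} → 0# ≤ x → 0# ≤ y → 0# ≤ x * y

  commutativeRing : CommutativeRing c ℓ₁
  commutativeRing = record { isCommutativeRing = isCommutativeRing }

  open NonStrictToStrict _≈_ _≤_ public using (_<_)

  fromℕ : ℕ → Carrier
  fromℕ n = RawMonoidDefinitions._×_ (CommutativeRing.+-rawMonoid commutativeRing) n 1#

  fromℤ : ℤ → Carrier
  fromℤ (+ n)    = fromℕ n
  fromℤ -[1+ n ] = - fromℕ (suc n)

  infixl 7 _÷_
  _÷_ : Carrier → Carrier → Carrier
  x ÷ y = x * y ⁻¹

-- The field of scalars in which φ and ε live: ℝ (classically) and ℚ are
-- instances.  The existence of integer parts is the Archimedean property.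
record ArchimedeanOrderedField c ℓ₁ ℓ₂ : Set (lsuc (c ⊔ ℓ₁ ⊔ ℓ₂)) where
  field
    orderedField : OrderedField c ℓ₁ ℓ₂

  open OrderedField orderedField public

  field
    ⌊_⌋      : Carrier → ℤ
    ⌊⌋-lower : ∀ x → fromℤ ⌊ x ⌋ ≤ x
    ⌊⌋-upper : ∀ x → x < fromℤ ⌊ x ⌋ + 1#

  ⌈_⌉ : Carrier → ℤ
  ⌈ x ⌉ = ℤ.- ⌊ - x ⌋

Weight : ℕ → Set
Weight M = ∃ λ w → 1 ℕ.≤ w × w ℕ.≤ M

Stream : Set u → ℕ → ℕ → Set u
Stream U M N = Vec (U × Weight M) N

volume : {U : Set u} → DecidableEquality U → ∀ {M N} → Stream U M N → U → ℕ
volume _≟_ ps x = sum (map (λ p → proj₁ (proj₂ p)) (filter (λ p → proj₁ p ≟ x) (toList ps)))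

-- Add is a relation, since an update may involve arbitrary choices.
record Algorithm (U : Set u) : Set (lsuc u) where
  field
    State   : Set u
    initial : State
    Add     : State → U → ℕ → State → Set u
    Query   : State → U → ℕ

module _ {U : Set u} (A : Algorithm U) where
  open Algorithm A

  data Process {M} : ∀ {N} → State → Stream U M N → State → Set u where
    []  : ∀ {σ} → Process σ [] σ
    _∷_ : ∀ {N σ σ′ σ″ x w w∈} {ps : Stream U M N} →
          Add σ x w σ′ → Process σ′ ps σ″ → Process σ ((x , w , w∈) ∷ ps) σ″

module _ {c ℓ₁ ℓ₂} (F : ArchimedeanOrderedField c ℓ₁ ℓ₂) where
  open ArchimedeanOrderedField F

  -- The first component excludes algorithms that get stuck on some stream.
  SolvesVolumeEstimation : {U : Set u} → DecidableEquality U →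
                           (ε : Carrier) (M : ℕ) → Algorithm U → Set (ℓ₂ ⊔ u)
  SolvesVolumeEstimation {U = U} _≟_ ε M A =
    ∀ {N} (ps : Stream U M N) →
    (∃ λ σ → Process A initial ps σ) ×
    (∀ {σ} → Process A initial ps σ → ∀ x →
       volume _≟_ ps x ℕ.≤ Query σ x ×
       fromℕ (Query σ x) ≤ fromℕ (volume _≟_ ps x) + fromℕ N * fromℕ M * ε)
    where open Algorithm A

-- C is a finite set, listed without repetition.
record FastState (U : Set u) : Set u where
  constructor ⟨_,_,_⟩
  field
    C   : List U
    c r : U → ℕ

module _ {U : Set u} (_≟_ : DecidableEquality U) (s ℭ : ℕ) .{{_ : NonZero s}} where
  open Membership {A = U} using (_∈_)
  open DecMembership _≟_ using (_∈?_)

  _∪⁅_⁆ : List U → U → List U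
  C ∪⁅ x ⁆ = if does (x ∈? C) then C else x ∷ C

  _∖⁅_⁆ : List U → U → List U
  C ∖⁅ m ⁆ = filter (λ y → ¬? (y ≟ m)) C

  _[_↦_] : (U → ℕ) → U → ℕ → U → ℕ
  (f [ x ↦ n ]) y = if does (y ≟ x) then n else f y

  -- Only used on nonempty lists: ℭ is positive.
  minimum : List ℕ → ℕ
  minimum []       = 0
  minimum (n ∷ ns) = foldr _⊓_ n ns

  Direct : List U → U → Set u
  Direct C x = x ∈ C ⊎ length C ℕ.< ℭ

  direct? : ∀ C x → Dec (Direct C x)
  direct? C x = x ∈? C ⊎-dec length C <? ℭ

  data FastAdd : FastState U → U → ℕ → FastState U → Set u where
    direct : ∀ {C c r x w} → Direct C x →
      FastAdd ⟨ C , c , r ⟩ x w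
              ⟨ C ∪⁅ x ⁆
              , c [ x ↦ c x ℕ.+ (r x ℕ.+ w) / s ]
              , r [ x ↦ (r x ℕ.+ w) % s ] ⟩
    evict : ∀ {C c r x w m} → ¬ Direct C x →
      m ∈ C → (∀ {y} → y ∈ C → c m ℕ.≤ c y) →
      FastAdd ⟨ C , c , r ⟩ x w
              ⟨ (C ∖⁅ m ⁆) ∪⁅ x ⁆
              , c [ x ↦ c m ℕ.+ (s ∸ 1 ℕ.+ w) / s ]
              , r [ x ↦ (s ∸ 1 ℕ.+ w) % s ] ⟩

  fastQuery : FastState U → U → ℕ
  fastQuery ⟨ C , c , r ⟩ x =
    if does (direct? C x)
      then r x ℕ.+ s ℕ.* c x
      else s ∸ 1 ℕ.+ s ℕ.* minimum (map c C)

  fastAlgorithm : Algorithm U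
  fastAlgorithm = record
    { State   = FastState U
    ; initial = ⟨ [] , (λ _ → 0) , (λ _ → 0) ⟩
    ; Add     = FastAdd
    ; Query   = fastQuery
    }

-- Time units charged for each elementary operation.
record Costs : Set where
  field
    hashAccess arithmetic groupMove itemInsert itemRemove : ℕ

Timed : Set a → Set a
Timed A = ℕ × A

cost : {A : Set a} → Timed A → ℕ
cost = proj₁

result : {A : Set a} → Timed A → A
result = proj₂

infixl 1 _>>=_
_>>=_ : {A : Set a} {B : Set b} → Timed A → (A → Timed B) → Timed B
t >>= f = cost t ℕ.+ cost (f (result t)) , result (f (result t))

-- An id and its remainder.
Item : Set u → Set u
Item U = U × ℕ

record Group (U : Set u) : Set u where
  constructor group
  field
    value : ℕ
    items : List⁺ (Item U)

open Group public

record SOS (U : Set u) : Set u where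
  constructor sos
  field
    size   : ℕ
    groups : List (Group U)

open SOS public

emptySOS : {U : Set u} → SOS U
emptySOS = sos 0 []

-- A pointer to an item's node, as a zipper into the linked list of groups.
record Node (U : Set u) : Set u where
  constructor node
  field
    before   : List (Group U)
    here     : Group U
    position : Fin (List⁺.length (items here))
    after    : List (Group U)

-- An arbitrary way of selecting an item of a group.
Pick : Set u → Set u
Pick U = (is : List⁺ (Item U)) → Fin (List⁺.length is)

-- The content of the hash table: the node of an id, if it has one.
findNode : {U : Set u} → DecidableEquality U → U → List (Group U) → Maybe (Node U)
findNode _≟_ x []       = nothing
findNode _≟_ x (g ∷ gs) with any? (λ i → x ≟ proj₁ i) (List⁺.toList (items g))
... | yes x∈g = just (node [] g (index x∈g) gs)
... | no  _   = Maybe.map (λ (node gs₁ h i gs₂) → node (g ∷ gs₁) h i gs₂) (findNode _≟_ x gs)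

-- Takes one item out of the group g, which precedes gs in the linked list;
-- the group disappears if this was its only item.
detach : {U : Set u} (g : Group U) → Fin (List⁺.length (items g)) → List (Group U) → List (Group U)
detach g i gs with removeAt (List⁺.toList (items g)) i
... | []     = gs
... | j ∷ js = group (value g) (j ∷ js) ∷ gs

module _ (costs : Costs) where
  open Costs costs

  -- Inserts an item with c-value v, walking from the first of the given groups.
  place : {U : Set u} → ℕ → Item U → List (Group U) → Timed (List (Group U))
  place v i []       = itemInsert , group v (i ∷ []) ∷ []
  place v i (g ∷ gs) = (arithmetic , <-cmp v (value g)) >>= λ where
    (tri< _ _ _) → itemInsert , group v (i ∷ []) ∷ g ∷ gs
    (tri≈ _ _ _) → itemInsert , group (value g) (i List⁺.∷⁺ items g) ∷ gs
    (tri> _ _ _) → do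
      _   ← groupMove , tt
      gs′ ← place v i gs
      0 , g ∷ gs′

  module _ {U : Set u} (_≟_ : DecidableEquality U) (s ℭ : ℕ) .{{_ : NonZero s}} where

    -- An id found in the hash table is moved upwards from its present group,
    -- so the groups before that one are not traversed.  An id without a node
    -- has c = r = 0 as long as there are free counters, and is then placed
    -- starting from the first group.  An evicted item is taken from the first
    -- group; there is one, because ℭ is positive.
    addSOS : Pick U → SOS U → U → ℕ → Timed (SOS U)
    addSOS pick S x w = (hashAccess , findNode _≟_ x (groups S)) >>= λ where
      (just (node gs₁ g i gs₂)) → do
        t   ← arithmetic , proj₂ (lookup (List⁺.toList (items g)) i) ℕ.+ w
        q   ← arithmetic , t / s
        r   ← arithmetic , t % s
        v   ← arithmetic , value g ℕ.+ q
        gs  ← itemRemove , detach g i gs₂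
        gs′ ← place v (x , r) gs
        hashAccess , sos (size S) (gs₁ ++ gs′)
      nothing → (arithmetic , (size S <? ℭ)) >>= λ where
        (yes _) → do
          v   ← arithmetic , w / s
          r   ← arithmetic , w % s
          gs  ← groupMove , groups S
          gs′ ← place v (x , r) gs
          n   ← arithmetic , suc (size S)
          hashAccess , sos n gs′
        (no _) → (groupMove , groups S) >>= λ where
          []       → 0 , S
          (g ∷ gs) → do
            s-1 ← arithmetic , s ∸ 1
            t   ← arithmetic , s-1 ℕ.+ w
            q   ← arithmetic , t / s
            r   ← arithmetic , t % s
            v   ← arithmetic , value g ℕ.+ q
            gs  ← itemRemove , detach g (pick (items g)) gs
            _   ← hashAccess , tt
            gs′ ← place v (x , r) gs
            hashAccess , sos (size S) gs′

    querySOS : SOS U → U → Timed ℕ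
    querySOS S x = (hashAccess , findNode _≟_ x (groups S)) >>= λ where
      (just (node _ g i _)) → do
        p ← arithmetic , s ℕ.* value g
        arithmetic , proj₂ (lookup (List⁺.toList (items g)) i) ℕ.+ p
      nothing → (arithmetic , (size S <? ℭ)) >>= λ where
        (yes _) → 0 , 0
        (no _)  → (groupMove , groups S) >>= λ where
          []      → 0 , 0
          (g ∷ _) → do
            s-1 ← arithmetic , s ∸ 1
            p   ← arithmetic , s ℕ.* value g
            arithmetic , s-1 ℕ.+ p

ids : {U : Set u} → List (Group U) → List U
ids = concatMap (λ g → map proj₁ (List⁺.toList (items g)))

record Represents {U : Set u} (S : SOS U) (σ : FastState U) : Set u where
  open FastState σ
  field
    size-C     : size S ≡ length C
    ids-C      : ids (groups S) ↭ C
    increasing : Linked (ℕ._<_ on value) (groups S)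
    contents   : All (λ g → All (λ (x , ρ) → c x ≡ value g × r x ≡ ρ)
                                (List⁺.toList (items g)))
                     (groups S)

module _ (costs : Costs) {U : Set u} (_≟_ : DecidableEquality U) (s ℭ : ℕ) .{{_ : NonZero s}} where
  open Algorithm (fastAlgorithm _≟_ s ℭ)

  -- The data structure implements the algorithm on streams with weights at
  -- most M, and every operation takes at most K time units.
  RunsInTime : (M K : ℕ) → Set u
  RunsInTime M K =
    Represents emptySOS initial ×
    (∀ {N} (ps : Stream U M N) {σ} → Process (fastAlgorithm _≟_ s ℭ) initial ps σ →
     ∀ {S} → Represents S σ →
       (∀ pick x ((w , _) : Weight M) →
          let t = addSOS costs _≟_ s ℭ pick S x w in
          cost t ℕ.≤ K × (∃ λ σ′ → Add σ x w σ′ × Represents (result t) σ′)) ×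
       (∀ x →
          let t = querySOS costs _≟_ s ℭ S x in
          cost t ℕ.≤ K × result t ≡ Query σ x))

module _ {c ℓ₁ ℓ₂} (F : ArchimedeanOrderedField c ℓ₁ ℓ₂) where
  open ArchimedeanOrderedField F

  stepSize : (M : ℕ) (φ : Carrier) → ℕ
  stepSize M φ = ℤ.∣ ⌊ fromℕ M * φ ÷ fromℕ 2 + 1# ⌋ ∣

  counters : (ε φ : Carrier) → ℕ
  counters ε φ = ℤ.∣ ⌈ (1# + φ) ÷ ε ⌉ ∣

  open CommutativeRing commutativeRing
    using (ring; +-identityˡ; +-comm; -‿inverseʳ; *-assoc; *-identityˡ; *-congʳ; -‿cong)
    renaming (sym to ≈-sym; trans to ≈-trans)
  open IsTotalOrder isTotalOrder
    using (total; antisym; ≤-respˡ-≈; ≤-respʳ-≈) renaming (trans to ≤-trans; refl to ≤-refl)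
  open RingProperties ring using (-‿distribˡ-*; -‿distribʳ-*; -‿involutive)

  square-nonneg : ∀ x → 0# ≤ x * x
  square-nonneg x with total 0# x
  ... | inj₁ 0≤x = *-nonneg 0≤x 0≤x
  ... | inj₂ x≤0 = ≤-respʳ-≈ [-x][-x]≈xx (*-nonneg 0≤-x 0≤-x)
    where
    0≤-x : 0# ≤ - x
    0≤-x = ≤-respˡ-≈ (-‿inverseʳ x) (≤-respʳ-≈ (+-identityˡ (- x)) (+-monoˡ-≤ (- x) x≤0))
    [-x][-x]≈xx : - x * - x ≈ x * x
    [-x][-x]≈xx = ≈-trans (≈-sym (-‿distribˡ-* x (- x)))
      (≈-trans (-‿cong (≈-sym (-‿distribʳ-* x x))) (-‿involutive (x * x)))

  +-nonneg : ∀ {x y} → 0# ≤ x → 0# ≤ y → 0# ≤ x + y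
  +-nonneg {x} {y} 0≤x 0≤y = ≤-trans 0≤y (≤-respˡ-≈ (+-identityˡ y) (+-monoˡ-≤ y 0≤x))

  1-nonneg : 0# ≤ 1#
  1-nonneg = ≤-respʳ-≈ (*-identityˡ 1#) (square-nonneg 1#)

  fromℕ-nonneg : ∀ n → 0# ≤ fromℕ n
  fromℕ-nonneg zero    = ≤-refl
  fromℕ-nonneg (suc n) = +-nonneg 1-nonneg (fromℕ-nonneg n)

  2≉0 : ¬ (fromℕ 2 ≈ 0#)
  2≉0 2≈0 = 0≉1 (antisym 1-nonneg (≤-respʳ-≈ 2≈0 1≤2))
    where
    1≤2 : 1# ≤ fromℕ 2
    1≤2 = ≤-respˡ-≈ (+-identityˡ 1#) (≤-respʳ-≈ (+-comm (fromℕ 1) 1#)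
            (+-monoˡ-≤ 1# (fromℕ-nonneg 1)))

  ½-nonneg : 0# ≤ fromℕ 2 ⁻¹
  ½-nonneg = ≤-respʳ-≈ eq (*-nonneg (fromℕ-nonneg 2) (square-nonneg (fromℕ 2 ⁻¹)))
    where
    eq : fromℕ 2 * (fromℕ 2 ⁻¹ * fromℕ 2 ⁻¹) ≈ fromℕ 2 ⁻¹
    eq = ≈-trans (≈-sym (*-assoc _ _ _)) (≈-trans (*-congʳ (*-inverseʳ 2≉0)) (*-identityˡ _))

  ∣⌊1+x⌋∣-nonZero : ∀ {x} → 0# ≤ x → NonZero ℤ.∣ ⌊ x + 1# ⌋ ∣
  ∣⌊1+x⌋∣-nonZero {x} 0≤x with ⌊ x + 1# ⌋ | ⌊⌋-upper (x + 1#)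
  ... | + suc _    | _           = _
  ... | -[1+ _ ]   | _           = _
  ... | + zero     | (≤1 , ≉1)   = contradiction (antisym ≤1 (+-monoˡ-≤ 1# 0≤x)) ≉1

  stepSize-nonZero : ∀ M {φ} → 0# < φ → NonZero (stepSize M φ)
  stepSize-nonZero M (0≤φ , _) = ∣⌊1+x⌋∣-nonZero (*-nonneg (*-nonneg (fromℕ-nonneg M) 0≤φ) ½-nonneg)

  FAST : {U : Set u} → DecidableEquality U → (M : ℕ) (ε φ : Carrier) → 0# < φ → Algorithm U
  FAST _≟_ M ε φ 0<φ = fastAlgorithm _≟_ (stepSize M φ) (counters ε φ) {{stepSize-nonZero M 0<φ}}

  FASTRunsInTime : Costs → {U : Set u} → DecidableEquality U →
                   (M : ℕ) (ε φ : Carrier) → 0# < φ → ℕ → Set u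
  FASTRunsInTime costs _≟_ M ε φ 0<φ =
    RunsInTime costs _≟_ (stepSize M φ) (counters ε φ) {{stepSize-nonZero M 0<φ}} M

{-# OPTIONS --safe #-}

module Submission where

-- An eviction raises the sum of the estimates r + s c over C by its weight plus
-- at most s - 1, the forgotten remainder, so after N additions the sum is at most
-- N (M + s - 1).  Once C is full, N >= ℭ, hence the value s - 1 + s min c taken by
-- an id outside C satisfies
--   ℭ (s - 1 + s min c) <= N (s - 1) + N (M + s - 1) = N (M + 2 (s - 1)) <= N M (1 + φ),
-- since s - 1 <= M φ / 2; with ℭ >= (1 + φ) / ε this is the bound N M ε.  An id in C
-- inherits its error from the moment it evicted another one, and an evicted id stays
-- below s - 1 + s min c because min c never decreases.
--
-- For the running time, s >= M φ / 2 gives M <= ⌈2 / φ⌉ s, so one addition raises c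
-- by at most ⌈2 / φ⌉.  Consecutive groups have increasing values, so this also bounds
-- the number of groups an item is moved past.

open import Defs
open import Data.Nat.Base using (ℕ; NonZero)
open import Data.Product.Base using (∃; _×_)
open import Relation.Binary.Definitions using (DecidableEquality)

open import Algebra.Bundles using (CommutativeRing)
import Algebra.Properties.CommutativeSemigroup as CommutativeSemigroupProperties
import Algebra.Properties.Monoid.Mult as MonoidMult
import Algebra.Properties.Ring as RingProperties
import Algebra.Properties.Semiring.Mult as SemiringMult
open import Data.Bool.Base using (if_then_else_)
open import Data.Fin.Base using (Fin; zero; suc)
import Data.Integer.Base as ℤ
open import Data.List.Base using (List; []; _∷_; _++_; length; map; foldr; lookup; removeAt)
import Data.List.Membership.DecPropositional as DecMembership
open import Data.List.Membership.Propositional using (_∈_; _∉_)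
open import Data.List.Membership.Propositional.Properties
  using (∈-filter⁻; ∈-map⁺; ∈-map⁻; ∈-++⁺ˡ; ∈-++⁺ʳ; ∈-++⁻; ∈-lookup; foldr-selective)
open import Data.List.NonEmpty.Base as List⁺ using (_∷_)
open import Data.List.Properties
  using (concatMap-++; filter-accept; filter-all; filter-reject; length-map; map-cong-local)
open import Data.List.Relation.Binary.Permutation.Propositional
  using (_↭_; ↭-refl; ↭-sym; ↭-trans; ↭-prep; ↭-swap; ↭-reflexive; ↭⇒↭ₛ; module PermutationReasoning)
open import Data.List.Relation.Binary.Permutation.Propositional.Properties
  using (∈-resp-↭; ↭-length; drop-∷; shift)
  renaming (++⁺ˡ to ↭-++⁺ˡ; ++⁺ʳ to ↭-++⁺ʳ; map⁺ to ↭-map⁺)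
import Data.List.Relation.Binary.Permutation.Setoid.Properties as SetoidPermutation
open import Data.List.Relation.Unary.All as All using (All; []; _∷_)
import Data.List.Relation.Unary.All.Properties as All
open import Data.List.Relation.Unary.AllPairs as AllPairs using (AllPairs; []; _∷_)
open import Data.List.Relation.Unary.Any using (here; there; any?)
import Data.List.Relation.Unary.Any.Properties as Any
open import Data.List.Relation.Unary.Linked using ([])
open import Data.List.Relation.Unary.Linked.Properties using (Linked⇒AllPairs; AllPairs⇒Linked)
open import Data.List.Relation.Unary.Unique.Propositional using (Unique)
open import Data.List.Relation.Unary.Unique.Propositional.Properties using (Unique[x∷xs]⇒x∉xs)
open import Data.Maybe.Base using (just; nothing)
open import Data.Nat.Base as ℕ using (zero; suc; _∸_; _⊓_; _/_; _%_; z≤n; s≤s; s≤s⁻¹; >-nonZero⁻¹)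
open import Data.Nat.DivMod using (m≡m%n+[m/n]*n; m%n<n; m<n*o⇒m/o<n)
open import Data.Nat.ListAction using (sum)
open import Data.Nat.ListAction.Properties using (sum-↭)
import Data.Nat.Properties as ℕₚ
open import Data.Nat.Solver using (module +-*-Solver)
open import Data.Product.Base using (_,_; proj₁; proj₂)
open import Data.Sum.Base using (inj₁; inj₂; [_,_]′)
open import Data.Vec.Base using ([]; _∷_)
open import Function.Base using (_∘_; _on_; _$_)
open import Level using (Level)
open import Relation.Binary.Bundles using (Poset)
open import Relation.Binary.Definitions using (tri<; tri≈; tri>)
open import Relation.Binary.PropositionalEquality
  using (_≡_; _≢_; refl; sym; trans; cong; cong₂; subst; subst₂; setoid; ≢-sym; module ≡-Reasoning)
import Relation.Binary.Reasoning.PartialOrder as PartialOrderReasoning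
open import Relation.Binary.Structures using (IsTotalOrder)
open import Relation.Nullary using (¬_; yes; no; contradiction)
open import Relation.Nullary.Decidable using (¬?; toSum; dec-true; dec-false)

-- Ordered-field arithmetic

module Scalars {c ℓ₁ ℓ₂ : Level} (F : ArchimedeanOrderedField c ℓ₁ ℓ₂) where
  open ArchimedeanOrderedField F
  open import Data.Integer.Base using (+_; -[1+_])
  open CommutativeRing commutativeRing hiding (Carrier; _≈_; _+_; _*_; -_; 0#; 1#; refl; sym; trans)
  open CommutativeRing commutativeRing using () renaming (sym to ≈-sym; trans to ≈-trans; refl to ≈-refl)
  open IsTotalOrder isTotalOrder using (antisym; isPartialOrder)
    renaming (trans to ≤-trans; refl to ≤-refl; reflexive to ≤-reflexive)
  open RingProperties ring using (-‿involutive; -0#≈0#)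
  open MonoidMult +-monoid using (×-homo-+)
  open SemiringMult semiring using (×1-homo-*)

  poset : Poset c ℓ₁ ℓ₂
  poset = record { isPartialOrder = isPartialOrder }

  open PartialOrderReasoning poset
  open CommutativeSemigroupProperties *-commutativeSemigroup using (x∙yz≈y∙xz)

  +-mono-≤ : ∀ {x y z w} → x ≤ y → z ≤ w → x + z ≤ y + w
  +-mono-≤ {x} {y} {z} {w} x≤y z≤w = begin
    x + z ≤⟨ +-monoˡ-≤ z x≤y ⟩
    y + z ≈⟨ +-comm y z ⟩
    z + y ≤⟨ +-monoˡ-≤ y z≤w ⟩
    w + y ≈⟨ +-comm w y ⟩
    y + w ∎

  +-cancelʳ-≤ : ∀ {x y} z → x + z ≤ y + z → x ≤ y
  +-cancelʳ-≤ {x} {y} z x+z≤y+z = begin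
    x             ≈⟨ cancel x ⟨
    x + z + - z   ≤⟨ +-monoˡ-≤ (- z) x+z≤y+z ⟩
    y + z + - z   ≈⟨ cancel y ⟩
    y             ∎
    where
    cancel : ∀ t → t + z + - z ≈ t
    cancel t = ≈-trans (+-assoc t z (- z)) (≈-trans (+-congˡ (-‿inverseʳ z)) (+-identityʳ t))

  *-monoʳ-≤ : ∀ {x y z} → 0# ≤ z → x ≤ y → z * x ≤ z * y
  *-monoʳ-≤ {x} {y} {z} 0≤z x≤y = +-cancelʳ-≤ (z * - x) (begin
    z * x + z * - x ≈⟨ distribˡ z x (- x) ⟨
    z * (x + - x)   ≈⟨ *-congˡ (-‿inverseʳ x) ⟩
    z * 0#          ≈⟨ zeroʳ z ⟩
    0#              ≤⟨ *-nonneg 0≤z 0≤y-x ⟩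
    z * (y + - x)   ≈⟨ distribˡ z y (- x) ⟩
    z * y + z * - x ∎)
    where
    0≤y-x : 0# ≤ y + - x
    0≤y-x = begin
      0#      ≈⟨ -‿inverseʳ x ⟨
      x + - x ≤⟨ +-monoˡ-≤ (- x) x≤y ⟩
      y + - x ∎

  *-monoˡ-≤ : ∀ {x y z} → 0# ≤ z → x ≤ y → x * z ≤ y * z
  *-monoˡ-≤ {x} {y} {z} 0≤z x≤y = begin
    x * z ≈⟨ *-comm x z ⟩
    z * x ≤⟨ *-monoʳ-≤ 0≤z x≤y ⟩
    z * y ≈⟨ *-comm z y ⟩
    y * z ∎

  -- Both negations stand on the right to fit `⌊ - x ⌋ ≤ - x`, the form in which the floor axiom
  -- reaches the ceiling.
  -‿anti-≤ : ∀ {x y} → x ≤ - y → y ≤ - x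
  -‿anti-≤ {x} {y} x≤-y = +-cancelʳ-≤ x (begin
    y + x   ≤⟨ +-mono-≤ (≤-refl {y}) x≤-y ⟩
    y + - y ≈⟨ -‿inverseʳ y ⟩
    0#      ≈⟨ -‿inverseˡ x ⟨
    - x + x ∎)

  <⇒≉0 : ∀ {x} → 0# < x → ¬ (x ≈ 0#)
  <⇒≉0 (_ , 0≉x) x≈0 = 0≉x (≈-sym x≈0)

  ÷-*-cancel : ∀ x {y} → 0# < y → x ÷ y * y ≈ x
  ÷-*-cancel x {y} 0<y = begin-equality
    x * y ⁻¹ * y   ≈⟨ *-assoc x (y ⁻¹) y ⟩
    x * (y ⁻¹ * y) ≈⟨ *-congˡ (*-comm (y ⁻¹) y) ⟩
    x * (y * y ⁻¹) ≈⟨ *-congˡ (*-inverseʳ (<⇒≉0 0<y)) ⟩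
    x * 1#         ≈⟨ *-identityʳ x ⟩
    x              ∎

  -- `x ⁻¹` is `x` times the square of `x ⁻¹`, a product of nonnegative factors.
  ⁻¹-nonneg : ∀ {x} → 0# < x → 0# ≤ x ⁻¹
  ⁻¹-nonneg {x} 0<x = begin
    0#                ≤⟨ *-nonneg (proj₁ 0<x) (square-nonneg F (x ⁻¹)) ⟩
    x * (x ⁻¹ * x ⁻¹) ≈⟨ *-assoc x (x ⁻¹) (x ⁻¹) ⟨
    x * x ⁻¹ * x ⁻¹   ≈⟨ *-congʳ (*-inverseʳ (<⇒≉0 0<x)) ⟩
    1# * x ⁻¹         ≈⟨ *-identityˡ (x ⁻¹) ⟩
    x ⁻¹              ∎

  *-cancelˡ-≤ : ∀ {x y z} → 0# < z → z * x ≤ z * y → x ≤ y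
  *-cancelˡ-≤ {x} {y} {z} 0<z zx≤zy = begin
    x            ≈⟨ cancel x ⟨
    z ⁻¹ * (z * x) ≤⟨ *-monoʳ-≤ (⁻¹-nonneg 0<z) zx≤zy ⟩
    z ⁻¹ * (z * y) ≈⟨ cancel y ⟩
    y            ∎
    where
    cancel : ∀ t → z ⁻¹ * (z * t) ≈ t
    cancel t = begin-equality
      z ⁻¹ * (z * t) ≈⟨ *-comm (z ⁻¹) (z * t) ⟩
      z * t * z ⁻¹   ≈⟨ *-congʳ (*-comm z t) ⟩
      t * z * z ⁻¹   ≈⟨ *-assoc t z (z ⁻¹) ⟩
      t * (z * z ⁻¹) ≈⟨ *-congˡ (*-inverseʳ (<⇒≉0 0<z)) ⟩
      t * 1#         ≈⟨ *-identityʳ t ⟩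
      t              ∎

  ÷≤⇒≤* : ∀ {x y z} → 0# < y → x ÷ y ≤ z → x ≤ z * y
  ÷≤⇒≤* {x} {y} {z} 0<y x÷y≤z = begin
    x         ≈⟨ ÷-*-cancel x 0<y ⟨
    x ÷ y * y ≤⟨ *-monoˡ-≤ (proj₁ 0<y) x÷y≤z ⟩
    z * y     ∎

  1≰0 : ¬ (1# ≤ 0#)
  1≰0 1≤0 = 0≉1 (antisym (1-nonneg F) 1≤0)

  fromℕ-mono-≤ : ∀ {m n} → m ℕ.≤ n → fromℕ m ≤ fromℕ n
  fromℕ-mono-≤ {n = n} z≤n   = fromℕ-nonneg F n
  fromℕ-mono-≤ (s≤s m≤n) = +-mono-≤ ≤-refl (fromℕ-mono-≤ m≤n)

  -- Brings inequalities from the field back to `ℕ`. The order on `ℕ` is decidable, and `n < m`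
  -- would give `1 + n ≤ m ≤ n` in the field, hence `1 ≤ 0`.
  fromℕ-cancel-≤ : ∀ {m n} → fromℕ m ≤ fromℕ n → m ℕ.≤ n
  fromℕ-cancel-≤ {m} {n} fm≤fn with m ℕₚ.≤? n
  ... | yes m≤n = m≤n
  ... | no  m≰n = contradiction (+-cancelʳ-≤ (fromℕ n) (begin
    1# + fromℕ n    ≤⟨ fromℕ-mono-≤ (ℕₚ.≰⇒> m≰n) ⟩
    fromℕ m         ≤⟨ fm≤fn ⟩
    fromℕ n         ≈⟨ +-identityˡ (fromℕ n) ⟨
    0# + fromℕ n    ∎)) 1≰0

  fromℕ-+ : ∀ m n → fromℕ (m ℕ.+ n) ≈ fromℕ m + fromℕ n
  fromℕ-+ = ×-homo-+ 1#

  fromℕ-* : ∀ m n → fromℕ (m ℕ.* n) ≈ fromℕ m * fromℕ n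
  fromℕ-* = ×1-homo-*

  0<fromℕ : ∀ n .{{_ : NonZero n}} → 0# < fromℕ n
  0<fromℕ n@(suc _) = fromℕ-nonneg F n , λ 0≈n →
    contradiction (fromℕ-cancel-≤ {n} {0} (≤-reflexive (≈-sym 0≈n))) λ ()

  -- Taking the absolute value only increases an integer, so lower bounds on floors and ceilings
  -- pass to the natural numbers `stepSize` and `counters` whatever the sign.
  fromℤ≤fromℕ∣∣ : ∀ i → fromℤ i ≤ fromℕ ℤ.∣ i ∣
  fromℤ≤fromℕ∣∣ (+ n)    = ≤-refl
  fromℤ≤fromℕ∣∣ -[1+ n ] = begin
    - fromℕ (suc n) ≤⟨ -‿anti-≤ (begin
      0#                ≤⟨ fromℕ-nonneg F (suc n) ⟩
      fromℕ (suc n)     ≈⟨ -‿involutive _ ⟨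
      - - fromℕ (suc n) ∎) ⟩
    - 0#            ≈⟨ -0#≈0# ⟩
    0#              ≤⟨ fromℕ-nonneg F (suc n) ⟩
    fromℕ (suc n)   ∎

  fromℤ-neg : ∀ i → fromℤ (ℤ.- i) ≈ - fromℤ i
  fromℤ-neg (+ zero)  = ≈-sym -0#≈0#
  fromℤ-neg (+ suc n) = ≈-refl
  fromℤ-neg -[1+ n ]  = ≈-sym (-‿involutive _)

  ≤∣⌈⌉∣ : ∀ x → x ≤ fromℕ ℤ.∣ ⌈ x ⌉ ∣
  ≤∣⌈⌉∣ x = begin
    x                  ≤⟨ -‿anti-≤ (⌊⌋-lower (- x)) ⟩
    - fromℤ ⌊ - x ⌋    ≈⟨ fromℤ-neg ⌊ - x ⌋ ⟨
    fromℤ ⌈ x ⌉        ≤⟨ fromℤ≤fromℕ∣∣ ⌈ x ⌉ ⟩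
    fromℕ ℤ.∣ ⌈ x ⌉ ∣  ∎

  ≤∣⌊1+⌋∣ : ∀ x → x ≤ fromℕ ℤ.∣ ⌊ x + 1# ⌋ ∣
  ≤∣⌊1+⌋∣ x = ≤-trans (+-cancelʳ-≤ 1# (proj₁ (⌊⌋-upper (x + 1#)))) (fromℤ≤fromℕ∣∣ ⌊ x + 1# ⌋)

  -- An upper bound survives the absolute value only for a nonnegative floor: a floor of at most -1
  -- would put `x` strictly below 0.
  ∣⌊⌋∣≤ : ∀ {x} → 0# ≤ x → fromℕ ℤ.∣ ⌊ x ⌋ ∣ ≤ x
  ∣⌊⌋∣≤ {x} 0≤x with ⌊ x ⌋ | ⌊⌋-lower x | ⌊⌋-upper x
  ... | + n      | n≤x | _         = n≤x
  ... | -[1+ n ] | _   | x<-n , x≉ = contradiction (antisym x<-n (begin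
    - fromℕ (suc n) + 1# ≤⟨ +-monoˡ-≤ 1# (-‿anti-≤ (begin
        1#                   ≈⟨ +-identityʳ 1# ⟨
        1# + 0#              ≤⟨ +-mono-≤ (≤-refl {1#}) (fromℕ-nonneg F n) ⟩
        fromℕ (suc n)        ≈⟨ -‿involutive _ ⟨
        - - fromℕ (suc n)    ∎)) ⟩
    - 1# + 1#            ≈⟨ -‿inverseˡ 1# ⟩
    0#                   ≤⟨ 0≤x ⟩
    x                    ∎)) x≉

  -- Bounds on the number of counters and on the step size

  module _ {ε φ : Carrier} (0<φ : 0# < φ) (0<ε : 0# < ε) where
    private
      ℭ : ℕ
      ℭ = counters F ε φ

    1+φ≤counters*ε : 1# + φ ≤ fromℕ ℭ * ε
    1+φ≤counters*ε = ÷≤⇒≤* 0<ε (≤∣⌈⌉∣ _)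

    -- With no counters, `1 ≤ 1 + φ ≤ 0 * ε = 0`. Positivity ensures that a full `C` has a least
    -- counter.
    counters-positive : 0 ℕ.< ℭ
    counters-positive with ℭ | 1+φ≤counters*ε
    ... | suc _ | _     = s≤s z≤n
    ... | zero  | 1+φ≤0 = contradiction (begin
      1#         ≈⟨ +-identityʳ 1# ⟨
      1# + 0#    ≤⟨ +-mono-≤ (≤-refl {1#}) (proj₁ 0<φ) ⟩
      1# + φ     ≤⟨ 1+φ≤0 ⟩
      0# * ε     ≈⟨ zeroˡ ε ⟩
      0#         ∎) 1≰0

  module _ (M : ℕ) {φ : Carrier} (0<φ : 0# < φ) where
    private
      s B : ℕ
      s = stepSize F M φ
      B = ℤ.∣ ⌈ fromℕ 2 ÷ φ ⌉ ∣

      half : Carrier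
      half = fromℕ M * φ ÷ fromℕ 2

    half*2 : half * fromℕ 2 ≈ fromℕ M * φ
    half*2 = ÷-*-cancel _ (0<fromℕ 2)

    half-nonneg : 0# ≤ half
    half-nonneg = *-nonneg (*-nonneg (fromℕ-nonneg F M) (proj₁ 0<φ)) (½-nonneg F)

    stepSize-upper : fromℕ (2 ℕ.* (s ∸ 1)) ≤ fromℕ M * φ
    stepSize-upper = begin
      fromℕ (2 ℕ.* (s ∸ 1))     ≈⟨ fromℕ-* 2 (s ∸ 1) ⟩
      fromℕ 2 * fromℕ (s ∸ 1)   ≤⟨ *-monoʳ-≤ (fromℕ-nonneg F 2) s-1≤ ⟩
      fromℕ 2 * half            ≈⟨ *-comm (fromℕ 2) half ⟩
      half * fromℕ 2            ≈⟨ half*2 ⟩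
      fromℕ M * φ               ∎
      where
      0≤half+1 : 0# ≤ half + 1#
      0≤half+1 = +-nonneg F half-nonneg (1-nonneg F)

      -- Truncated subtraction leaves 0 at 0, where the bound is just the nonnegativity of `half`.
      pred≤ : ∀ n → fromℕ n ≤ half + 1# → fromℕ (n ∸ 1) ≤ half
      pred≤ zero    _      = half-nonneg
      pred≤ (suc n) 1+n≤ = +-cancelʳ-≤ 1# (≤-trans (≤-reflexive (+-comm (fromℕ n) 1#)) 1+n≤)

      s-1≤ : fromℕ (s ∸ 1) ≤ half
      s-1≤ = pred≤ s (∣⌊⌋∣≤ 0≤half+1)

    -- Doubling both sides avoids division: `2 M ≤ B φ M = B (2 half) ≤ 2 B s`, from `2 ≤ B φ` and
    -- `half ≤ s`.
    maxWeight≤ : M ℕ.≤ B ℕ.* s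
    maxWeight≤ = fromℕ-cancel-≤ (*-cancelˡ-≤ (0<fromℕ 2) (begin
      fromℕ 2 * fromℕ M                   ≤⟨ *-monoˡ-≤ (fromℕ-nonneg F M) (÷≤⇒≤* 0<φ (≤∣⌈⌉∣ _)) ⟩
      fromℕ B * φ * fromℕ M               ≈⟨ *-assoc _ _ _ ⟩
      fromℕ B * (φ * fromℕ M)             ≈⟨ *-congˡ (≈-trans (*-comm φ _) (≈-sym half*2)) ⟩
      fromℕ B * (half * fromℕ 2)          ≤⟨ *-monoʳ-≤ (fromℕ-nonneg F B) (*-monoˡ-≤ (fromℕ-nonneg F 2) (≤∣⌊1+⌋∣ half)) ⟩
      fromℕ B * (fromℕ s * fromℕ 2)       ≈⟨ *-assoc _ _ _ ⟨
      fromℕ B * fromℕ s * fromℕ 2         ≈⟨ *-comm _ _ ⟩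
      fromℕ 2 * (fromℕ B * fromℕ s)       ≈⟨ *-congˡ (fromℕ-* B s) ⟨
      fromℕ 2 * fromℕ (B ℕ.* s)           ∎))

    -- Turns the error bound kept in `ℕ`, multiplied through by `ℭ`, into the one in the field:
    -- `M + 2 (s ∸ 1) ≤ M (1 + φ) ≤ M ℭ ε`, after which `ℭ` cancels.
    scaled-error-bound : ∀ {ε v q} n → 0# < ε → let ℭ = counters F ε φ in
      ℭ ℕ.* q ℕ.≤ ℭ ℕ.* v ℕ.+ n ℕ.* (M ℕ.+ 2 ℕ.* (s ∸ 1)) →
      fromℕ q ≤ fromℕ v + fromℕ n * fromℕ M * ε
    scaled-error-bound {ε} {v} {q} n 0<ε ℭq≤ = *-cancelˡ-≤ (0<fromℕ ℭ {{ℕ.>-nonZero (counters-positive 0<φ 0<ε)}}) (begin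
      fromℕ ℭ * fromℕ q                                            ≈⟨ fromℕ-* ℭ q ⟨
      fromℕ (ℭ ℕ.* q)                                              ≤⟨ fromℕ-mono-≤ ℭq≤ ⟩
      fromℕ (ℭ ℕ.* v ℕ.+ n ℕ.* (M ℕ.+ 2 ℕ.* (s ∸ 1)))              ≈⟨ fromℕ-+ (ℭ ℕ.* v) _ ⟩
      fromℕ (ℭ ℕ.* v) + fromℕ (n ℕ.* (M ℕ.+ 2 ℕ.* (s ∸ 1)))        ≈⟨ +-cong (fromℕ-* ℭ v) (fromℕ-* n _) ⟩
      fromℕ ℭ * fromℕ v + fromℕ n * fromℕ (M ℕ.+ 2 ℕ.* (s ∸ 1))    ≤⟨ +-mono-≤ ≤-refl (*-monoʳ-≤ (fromℕ-nonneg F n) increment≤) ⟩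
      fromℕ ℭ * fromℕ v + fromℕ n * (fromℕ M * (fromℕ ℭ * ε))      ≈⟨ +-congˡ (*-assoc _ _ _) ⟨
      fromℕ ℭ * fromℕ v + fromℕ n * fromℕ M * (fromℕ ℭ * ε)        ≈⟨ +-congˡ (x∙yz≈y∙xz _ _ _) ⟩
      fromℕ ℭ * fromℕ v + fromℕ ℭ * (fromℕ n * fromℕ M * ε)        ≈⟨ distribˡ _ _ _ ⟨
      fromℕ ℭ * (fromℕ v + fromℕ n * fromℕ M * ε)                  ∎)
      where
      ℭ : ℕ
      ℭ = counters F ε φ
      increment≤ : fromℕ (M ℕ.+ 2 ℕ.* (s ∸ 1)) ≤ fromℕ M * (fromℕ ℭ * ε)
      increment≤ = begin
        fromℕ (M ℕ.+ 2 ℕ.* (s ∸ 1))           ≈⟨ fromℕ-+ M _ ⟩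
        fromℕ M + fromℕ (2 ℕ.* (s ∸ 1))       ≤⟨ +-mono-≤ ≤-refl stepSize-upper ⟩
        fromℕ M + fromℕ M * φ                 ≈⟨ +-congʳ (*-identityʳ (fromℕ M)) ⟨
        fromℕ M * 1# + fromℕ M * φ            ≈⟨ distribˡ (fromℕ M) 1# φ ⟨
        fromℕ M * (1# + φ)                    ≤⟨ *-monoʳ-≤ (fromℕ-nonneg F M) (1+φ≤counters*ε 0<φ 0<ε) ⟩
        fromℕ M * (fromℕ ℭ * ε)               ∎

-- Lists up to permutation

Unique-resp-↭ : ∀ {a} {A : Set a} {xs ys : List A} → xs ↭ ys → Unique xs → Unique ys
Unique-resp-↭ {A = A} xs↭ys = SetoidPermutation.Unique-resp-↭ (setoid A) (↭⇒↭ₛ xs↭ys)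

sum-map-≥ : ∀ {a} {A : Set a} (f : A → ℕ) {k xs} → (∀ {x} → x ∈ xs → k ℕ.≤ f x) → length xs ℕ.* k ℕ.≤ sum (map f xs)
sum-map-≥ f {xs = []}     k≤ = z≤n
sum-map-≥ f {xs = x ∷ xs} k≤ = ℕₚ.+-mono-≤ (k≤ (here refl)) (sum-map-≥ f (k≤ ∘ there))

removeAt-↭ : ∀ {a} {A : Set a} (xs : List A) i → xs ↭ lookup xs i ∷ removeAt xs i
removeAt-↭ (x ∷ xs) zero    = ↭-refl
removeAt-↭ (x ∷ xs) (suc i) = ↭-trans (↭-prep x (removeAt-↭ xs i)) (↭-swap x (lookup xs i) ↭-refl)

All-removeAt : ∀ {a p} {A : Set a} {P : A → Set p} {xs} i → All P xs → All P (removeAt xs i)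
All-removeAt zero    (_ ∷ pxs)  = pxs
All-removeAt (suc i) (px ∷ pxs) = px ∷ All-removeAt i pxs

-- The algorithm on counters

module Fast {u : Level} {U : Set u} (_≟_ : DecidableEquality U) (s ℭ : ℕ) .{{_ : NonZero s}} where
  open import Data.Nat.Base using (_+_; _*_; _≤_; _<_)
  open ℕₚ hiding (_≟_)
  open DecMembership _≟_ using (_∈?_)
  open CommutativeSemigroupProperties +-commutativeSemigroup using (xy∙z≈xz∙y)

  infixl 6 _∪_
  _∪_ : List U → U → List U
  C ∪ x = _∪⁅_⁆ _≟_ s ℭ C x

  _∖_ : List U → U → List U
  C ∖ m = _∖⁅_⁆ _≟_ s ℭ C m

  update : (U → ℕ) → U → ℕ → U → ℕ
  update = _[_↦_] _≟_ s ℭ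

  update-same : ∀ f x n → update f x n x ≡ n
  update-same f x n with x ≟ x
  ... | yes _  = refl
  ... | no x≢x = contradiction refl x≢x

  update-other : ∀ f {x y} n → y ≢ x → update f x n y ≡ f y
  update-other f {x} {y} n y≢x with y ≟ x
  ... | yes y≡x = contradiction y≡x y≢x
  ... | no _    = refl

  ∪-∈ : ∀ {C x} → x ∈ C → C ∪ x ≡ C
  ∪-∈ {C} {x} x∈C with x ∈? C
  ... | yes _  = refl
  ... | no x∉C = contradiction x∈C x∉C

  ∪-∉ : ∀ {C x} → x ∉ C → C ∪ x ≡ x ∷ C
  ∪-∉ {C} {x} x∉C with x ∈? C
  ... | yes x∈C = contradiction x∈C x∉C
  ... | no _    = refl

  ∖-⊆ : ∀ {C m y} → y ∈ C ∖ m → y ∈ C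
  ∖-⊆ {m = m} = proj₁ ∘ ∈-filter⁻ (λ y → ¬? (y ≟ m))

  -- Filtering removes every copy of `m`; uniqueness makes this exactly one.
  ∷-∖-↭ : ∀ {C m} → Unique C → m ∈ C → C ↭ m ∷ C ∖ m
  ∷-∖-↭ {m ∷ C} (m≢C ∷ _) (here refl) = ↭-prep m (↭-reflexive (sym (trans
    (filter-reject (λ y → ¬? (y ≟ m)) (λ m≢m → m≢m refl))
    (filter-all (λ y → ¬? (y ≟ m)) (All.map ≢-sym m≢C)))))
  ∷-∖-↭ {y ∷ C} {m} (y≢C ∷ C!) (there m∈C) = ↭-trans
    (↭-trans (↭-prep y (∷-∖-↭ C! m∈C)) (↭-swap y m ↭-refl))
    (↭-prep m (↭-reflexive (sym (filter-accept (λ z → ¬? (z ≟ m)) (All.lookup y≢C m∈C)))))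

  Unique-∷-∖ : ∀ {C m} → Unique C → m ∈ C → Unique (m ∷ C ∖ m)
  Unique-∷-∖ C! m∈C = Unique-resp-↭ (∷-∖-↭ C! m∈C) C!

  estimate : (c r : U → ℕ) → U → ℕ
  estimate c r x = r x + s * c x

  -- Division with remainder: carrying the quotient into the counter loses nothing, so `t`
  -- contributes exactly `t` to the estimate. A direct update has `t = r x + w`, an eviction
  -- `t = s ∸ 1 + w`.
  carry : ∀ t k → t % s + s * (k + t / s) ≡ t + s * k
  carry t k = begin
    t % s + s * (k + t / s)       ≡⟨ cong (t % s +_) (trans (*-distribˡ-+ s k (t / s)) (+-comm (s * k) _)) ⟩
    t % s + (s * (t / s) + s * k) ≡⟨ +-assoc (t % s) _ _ ⟨
    t % s + s * (t / s) + s * k   ≡⟨ cong (λ z → t % s + z + s * k) (*-comm s (t / s)) ⟩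
    t % s + t / s * s + s * k     ≡⟨ cong (_+ s * k) (m≡m%n+[m/n]*n t s) ⟨
    t + s * k                     ∎
    where open ≡-Reasoning

  -- v is the volume of the n pairs processed so far.
  record Invariant (M n : ℕ) (v : U → ℕ) (σ : FastState U) : Set u where
    open FastState σ
    field
      unique      : Unique C
      size≤ℭ      : length C ≤ ℭ
      size≤n      : length C ≤ n
      remainder<s : ∀ {y} → y ∈ C → r y < s
      -- An eviction adds to the total its weight and at most s ∸ 1 for the
      -- forgotten remainder.
      total       : sum (map (estimate c r) C) ≤ n * (M + (s ∸ 1))
      lower       : ∀ {y} → y ∈ C → v y ≤ estimate c r y
      -- Multiplied by `ℭ`, so that the average over the counters needs no division.
      upper       : ∀ {y} → y ∈ C → ℭ * estimate c r y ≤ ℭ * v y + n * (M + 2 * (s ∸ 1))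
      -- While there is room nothing has been evicted, so an id outside `C` has not occurred.
      fresh       : ∀ {y} → y ∉ C → length C < ℭ → c y ≡ 0 × r y ≡ 0 × v y ≡ 0
      -- Ranging over all `z` in `C` amounts to a bound by the least counter, without naming a
      -- minimum that may change.
      evicted     : ∀ {y z} → y ∉ C → ℭ ≤ length C → z ∈ C → v y ≤ s ∸ 1 + s * c z

  -- Preservation of the invariant by one addition

  module _ {M n : ℕ} {v : U → ℕ} {C : List U} {c r : U → ℕ} (I : Invariant M n v ⟨ C , c , r ⟩) where
    open Invariant I

    -- A full C has received at least ℭ weights, which pays for the s ∸ 1.
    minimum-bound : ∀ {k} → ℭ ≤ length C → (∀ {y} → y ∈ C → k ≤ c y) →
                    ℭ * (s ∸ 1 + s * k) ≤ n * (M + 2 * (s ∸ 1))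
    minimum-bound {k} ℭ≤C k≤c = begin
      ℭ * (s ∸ 1 + s * k)                ≡⟨ *-distribˡ-+ ℭ (s ∸ 1) (s * k) ⟩
      ℭ * (s ∸ 1) + ℭ * (s * k)          ≤⟨ +-mono-≤ (*-monoˡ-≤ (s ∸ 1) (≤-trans ℭ≤C size≤n)) ℭsk≤ ⟩
      n * (s ∸ 1) + n * (M + (s ∸ 1))    ≡⟨ regroup n M (s ∸ 1) ⟩
      n * (M + 2 * (s ∸ 1))              ∎
      where
      open ≤-Reasoning
      open +-*-Solver
      regroup : ∀ n M t → n * t + n * (M + t) ≡ n * (M + 2 * t)
      regroup = solve 3 (λ n M t → n :* t :+ n :* (M :+ t) := n :* (M :+ con 2 :* t)) refl
      ℭsk≤ : ℭ * (s * k) ≤ n * (M + (s ∸ 1))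
      ℭsk≤ = ≤-trans (*-monoˡ-≤ (s * k) ℭ≤C)
        (≤-trans (sum-map-≥ (estimate c r) λ y∈C → m≤n⇒m≤o+n (r _) (*-monoʳ-≤ s (k≤c y∈C))) total)

    -- `Direct` also admits ids outside `C` while there is room; by `fresh` these have volume 0.
    direct-lower : ∀ {x} → Direct _≟_ s ℭ C x → v x ≤ estimate c r x
    direct-lower (inj₁ x∈C) = lower x∈C
    direct-lower {x} (inj₂ C<ℭ) with x ∈? C
    ... | yes x∈C = lower x∈C
    ... | no  x∉C = ≤-trans (≤-reflexive (proj₂ (proj₂ (fresh x∉C C<ℭ)))) z≤n

    direct-upper : ∀ {x} → Direct _≟_ s ℭ C x → ℭ * estimate c r x ≤ ℭ * v x + n * (M + 2 * (s ∸ 1))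
    direct-upper (inj₁ x∈C) = upper x∈C
    direct-upper {x} (inj₂ C<ℭ) with x ∈? C
    ... | yes x∈C = upper x∈C
    ... | no  x∉C with fresh x∉C C<ℭ
    ...   | cx≡0 , rx≡0 , _ rewrite cx≡0 | rx≡0 | *-zeroʳ s | *-zeroʳ ℭ = z≤n

    -- Every update makes room for x, leaving the counters D unchanged, and then
    -- stores the estimate ρ + s * κ for x.
    store : ∀ {x w ρ κ C′ D} → (∀ {y} → y ∈ D → y ∈ C) → Unique (x ∷ D) → ρ < s → C′ ↭ x ∷ D →
      length (x ∷ D) ≤ ℭ → length (x ∷ D) ≤ suc n →
      (ρ + s * κ) + sum (map (estimate c r) D) ≤ suc n * (M + (s ∸ 1)) →
      v x + w ≤ ρ + s * κ →
      ℭ * (ρ + s * κ) ≤ ℭ * (v x + w) + suc n * (M + 2 * (s ∸ 1)) →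
      (∀ {y} → y ∉ x ∷ D → length (x ∷ D) < ℭ → c y ≡ 0 × r y ≡ 0 × v y ≡ 0) →
      (∀ {y} → y ∉ x ∷ D → ℭ ≤ length (x ∷ D) → v y ≤ s ∸ 1 + s * κ × (∀ {z} → z ∈ D → v y ≤ s ∸ 1 + s * c z)) →
      Invariant M (suc n) (update v x (v x + w)) ⟨ C′ , update c x κ , update r x ρ ⟩
    store {x} {w} {ρ} {κ} {C′} {D} D⊆C xD! ρ<s C′↭ xD≤ℭ xD≤n total′ lower′ upper′ fresh′ evicted′ = record
      { unique      = Unique-resp-↭ (↭-sym C′↭) xD!
      ; size≤ℭ      = subst (_≤ ℭ) |xD|≡ xD≤ℭ
      ; size≤n      = subst (_≤ suc n) |xD|≡ xD≤n
      ; remainder<s = λ y∈ → stored (λ y → r′ y < s)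
          (subst (_< s) (sym (update-same r x ρ)) ρ<s)
          (λ y∈D y≢x → subst (_< s) (sym (update-other r ρ y≢x)) (remainder<s (D⊆C y∈D))) y∈
      ; total       = begin
          sum (map est′ C′)                             ≡⟨ sum-↭ (↭-map⁺ est′ C′↭) ⟩
          est′ x + sum (map est′ D)                     ≡⟨ cong₂ _+_ est′-same (cong sum (map-cong-local
                                                             (All.tabulate λ y∈D → est′-other (≢x y∈D)))) ⟩
          (ρ + s * κ) + sum (map (estimate c r) D)      ≤⟨ total′ ⟩
          suc n * (M + (s ∸ 1))                         ∎
      ; lower       = stored (λ y → v′ y ≤ est′ y)
          (subst₂ _≤_ (sym v′-same) (sym est′-same) lower′)
          (λ y∈D y≢x → subst₂ _≤_ (sym (v′-other y≢x)) (sym (est′-other y≢x)) (lower (D⊆C y∈D)))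
      ; upper       = stored (λ y → ℭ * est′ y ≤ ℭ * v′ y + suc n * (M + 2 * (s ∸ 1)))
          (begin
            ℭ * est′ x                                    ≡⟨ cong (ℭ *_) est′-same ⟩
            ℭ * (ρ + s * κ)                               ≤⟨ upper′ ⟩
            ℭ * (v x + w) + suc n * (M + 2 * (s ∸ 1))     ≡⟨ cong (λ z → ℭ * z + _) v′-same ⟨
            ℭ * v′ x + suc n * (M + 2 * (s ∸ 1))          ∎)
          (λ {y} y∈D y≢x → begin
            ℭ * est′ y                                    ≡⟨ cong (ℭ *_) (est′-other y≢x) ⟩
            ℭ * estimate c r y                            ≤⟨ upper (D⊆C y∈D) ⟩
            ℭ * v y + n * (M + 2 * (s ∸ 1))               ≤⟨ +-monoʳ-≤ (ℭ * v y) (m≤n+m _ _) ⟩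
            ℭ * v y + suc n * (M + 2 * (s ∸ 1))           ≡⟨ cong (λ z → ℭ * z + _) (v′-other y≢x) ⟨
            ℭ * v′ y + suc n * (M + 2 * (s ∸ 1))          ∎)
      ; fresh       = λ y∉C′ C′<ℭ →
          let y∉xD = y∉C′ ∘ ∈-resp-↭ (↭-sym C′↭)
              y≢x  = y∉xD ∘ here
              cy≡0 , ry≡0 , vy≡0 = fresh′ y∉xD (subst (_< ℭ) (sym |xD|≡) C′<ℭ)
          in trans (update-other c κ y≢x) cy≡0 , trans (update-other r ρ y≢x) ry≡0 , trans (v′-other y≢x) vy≡0
      ; evicted     = λ {y} y∉C′ ℭ≤C′ →
          let y∉xD = y∉C′ ∘ ∈-resp-↭ (↭-sym C′↭)
              vy≤κ , vy≤D = evicted′ y∉xD (subst (ℭ ≤_) (sym |xD|≡) ℭ≤C′)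
              vy≡ = sym (v′-other (y∉xD ∘ here))
          in stored (λ z → v′ y ≤ s ∸ 1 + s * c′ z)
               (subst₂ _≤_ vy≡ (cong (λ k → s ∸ 1 + s * k) (sym (update-same c x κ))) vy≤κ)
               (λ z∈D z≢x → subst₂ _≤_ vy≡ (cong (λ k → s ∸ 1 + s * k) (sym (update-other c κ z≢x))) (vy≤D z∈D))
      }
      where
      open ≤-Reasoning
      c′ r′ v′ est′ : U → ℕ
      c′ = update c x κ
      r′ = update r x ρ
      v′ = update v x (v x + w)
      est′ = estimate c′ r′
      |xD|≡ : length (x ∷ D) ≡ length C′
      |xD|≡ = sym (↭-length C′↭)
      ≢x : ∀ {y} → y ∈ D → y ≢ x
      ≢x y∈D refl = Unique[x∷xs]⇒x∉xs xD! y∈D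
      est′-same : est′ x ≡ ρ + s * κ
      est′-same = cong₂ (λ ρ κ → ρ + s * κ) (update-same r x ρ) (update-same c x κ)
      est′-other : ∀ {y} → y ≢ x → est′ y ≡ estimate c r y
      est′-other y≢x = cong₂ (λ ρ κ → ρ + s * κ) (update-other r ρ y≢x) (update-other c κ y≢x)
      v′-same : v′ x ≡ v x + w
      v′-same = update-same v x _
      v′-other : ∀ {y} → y ≢ x → v′ y ≡ v y
      v′-other = update-other v _
      -- A member of `C′` is either `x`, with its new values, or a member of `D`, which differs from
      -- `x` and keeps its old ones.
      stored : ∀ {p} (P : U → Set p) → P x → (∀ {y} → y ∈ D → y ≢ x → P y) → ∀ {y} → y ∈ C′ → P y
      stored P Px PD y∈C′ with ∈-resp-↭ C′↭ y∈C′
      ... | here refl = Px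
      ... | there y∈D = PD y∈D (≢x y∈D)

    module _ {x : U} {w : ℕ} (w≤M : w ≤ M) where
      private
        v′ : U → ℕ
        v′ = update v x (v x + w)

      -- Shared by the two kinds of direct update: `D` is `C ∖ x` when `x` has a counter and `C`
      -- itself when it does not. Estimate and volume both grow by exactly `w`, so the error of `x`
      -- is unchanged.
      direct-step : Direct _≟_ s ℭ C x →
        ∀ {C′ D} → (∀ {y} → y ∈ D → y ∈ C) → Unique (x ∷ D) → C′ ↭ x ∷ D →
        length (x ∷ D) ≤ ℭ → length (x ∷ D) ≤ suc n →
        estimate c r x + sum (map (estimate c r) D) ≤ n * (M + (s ∸ 1)) →
        (∀ {y} → y ∉ x ∷ D → length (x ∷ D) < ℭ → c y ≡ 0 × r y ≡ 0 × v y ≡ 0) →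
        (∀ {y} → y ∉ x ∷ D → ℭ ≤ length (x ∷ D) →
           v y ≤ s ∸ 1 + s * c x × (∀ {z} → z ∈ D → v y ≤ s ∸ 1 + s * c z)) →
        Invariant M (suc n) v′
          ⟨ C′ , update c x (c x + (r x + w) / s) , update r x ((r x + w) % s) ⟩
      direct-step dir {D = D} D⊆C xD! C′↭ xD≤ℭ xD≤n total′ fresh′ evicted′ =
        store D⊆C xD! (m%n<n (r x + w) s) C′↭ xD≤ℭ xD≤n
          (begin
            new + ΣD                            ≡⟨ cong (_+ ΣD) (trans new≡ (+-comm old w)) ⟩
            w + old + ΣD                        ≡⟨ +-assoc w old ΣD ⟩
            w + (old + ΣD)                      ≤⟨ +-mono-≤ (m≤n⇒m≤n+o (s ∸ 1) w≤M) total′ ⟩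
            suc n * (M + (s ∸ 1))               ∎)
          (subst (v x + w ≤_) (sym new≡) (+-monoˡ-≤ w (direct-lower dir)))
          (begin
            ℭ * new                                      ≡⟨ cong (ℭ *_) new≡ ⟩
            ℭ * (old + w)                                ≡⟨ *-distribˡ-+ ℭ old w ⟩
            ℭ * old + ℭ * w                              ≤⟨ +-monoˡ-≤ (ℭ * w) (direct-upper dir) ⟩
            ℭ * v x + n * (M + 2 * (s ∸ 1)) + ℭ * w      ≤⟨ +-monoˡ-≤ (ℭ * w) (+-monoʳ-≤ (ℭ * v x) (m≤n+m _ _)) ⟩
            ℭ * v x + suc n * (M + 2 * (s ∸ 1)) + ℭ * w  ≡⟨ regroup ℭ (v x) w _ ⟩
            ℭ * (v x + w) + suc n * (M + 2 * (s ∸ 1))    ∎)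
          fresh′
          -- The counter of `x` does not decrease, so bounds by its old value persist.
          (λ y∉ ℭ≤ → let vy≤x , vy≤D = evicted′ y∉ ℭ≤ in
             ≤-trans vy≤x (+-monoʳ-≤ (s ∸ 1) (*-monoʳ-≤ s (m≤m+n (c x) _))) , vy≤D)
        where
        open ≤-Reasoning
        old new ΣD : ℕ
        old = estimate c r x
        new = (r x + w) % s + s * (c x + (r x + w) / s)
        ΣD  = sum (map (estimate c r) D)
        regroup : ∀ k a b t → k * a + t + k * b ≡ k * (a + b) + t
        regroup = solve 4 (λ k a b t → k :* a :+ t :+ k :* b := k :* (a :+ b) :+ t) refl
          where open +-*-Solver
        new≡ : new ≡ old + w
        new≡ = trans (carry (r x + w) (c x)) (xy∙z≈xz∙y (r x) w (s * c x))

      hit-step : x ∈ C →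
        Invariant M (suc n) v′
          ⟨ C ∪ x , update c x (c x + (r x + w) / s) , update r x ((r x + w) % s) ⟩
      hit-step x∈C = direct-step (inj₁ x∈C) ∖-⊆ (Unique-∷-∖ unique x∈C)
        (subst (_↭ x ∷ C ∖ x) (sym (∪-∈ x∈C)) C↭)
        (subst (_≤ ℭ) |C|≡ size≤ℭ) (m≤n⇒m≤1+n (subst (_≤ n) |C|≡ size≤n))
        (subst (_≤ n * (M + (s ∸ 1))) (sum-↭ (↭-map⁺ (estimate c r) C↭)) total)
        (λ y∉ <ℭ → fresh (y∉ ∘ ∈-resp-↭ C↭) (subst (_< ℭ) (sym |C|≡) <ℭ))
        (λ y∉ ℭ≤ → let y∉C = y∉ ∘ ∈-resp-↭ C↭
                       ℭ≤C = subst (ℭ ≤_) (sym |C|≡) ℭ≤ in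
           evicted y∉C ℭ≤C x∈C , evicted y∉C ℭ≤C ∘ ∖-⊆)
        where
        C↭ : C ↭ x ∷ C ∖ x
        C↭ = ∷-∖-↭ unique x∈C
        |C|≡ : length C ≡ length (x ∷ C ∖ x)
        |C|≡ = ↭-length C↭

      new-step : x ∉ C → length C < ℭ →
        Invariant M (suc n) v′
          ⟨ C ∪ x , update c x (c x + (r x + w) / s) , update r x ((r x + w) % s) ⟩
      new-step x∉C C<ℭ with fresh x∉C C<ℭ
      ... | cx≡0 , rx≡0 , _ = direct-step (inj₂ C<ℭ) (λ y∈C → y∈C) (All.¬Any⇒All¬ C x∉C ∷ unique)
        (↭-reflexive (∪-∉ x∉C)) C<ℭ (s≤s size≤n)
        (subst (λ e → e + sum (map (estimate c r) C) ≤ n * (M + (s ∸ 1))) (sym est≡0) total)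
        (λ y∉ _ → fresh (y∉ ∘ there) C<ℭ)
        -- This insertion may fill `C`, but there was room before it, so the ids still outside have
        -- volume 0.
        (λ y∉ _ → let vy≡0 = proj₂ (proj₂ (fresh (y∉ ∘ there) C<ℭ)) in
           ≤-trans (≤-reflexive vy≡0) z≤n , λ _ → ≤-trans (≤-reflexive vy≡0) z≤n)
        where
        est≡0 : estimate c r x ≡ 0
        est≡0 = cong₂ _+_ rx≡0 (trans (cong (s *_) cx≡0) (*-zeroʳ s))

      -- Apart from `w`, the new estimate of `x` is `s ∸ 1 + s * c m`, the value that a query for
      -- `x` returned so far. The volume is below it by `evicted`, and `minimum-bound` keeps this
      -- whole value within the allowed error.
      evict-step : ∀ {m} → x ∉ C → ℭ ≤ length C → m ∈ C → (∀ {y} → y ∈ C → c m ≤ c y) →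
        Invariant M (suc n) v′
          ⟨ (C ∖ m) ∪ x , update c x (c m + (s ∸ 1 + w) / s) , update r x ((s ∸ 1 + w) % s) ⟩
      evict-step {m} x∉C ℭ≤C m∈C m-min = store ∖-⊆ xD! (m%n<n (s ∸ 1 + w) s)
        (↭-reflexive (∪-∉ (x∉C ∘ ∖-⊆)))
        (subst (_≤ ℭ) |C|≡ size≤ℭ) (m≤n⇒m≤1+n (subst (_≤ n) |C|≡ size≤n))
        (begin
          new + ΣD                              ≡⟨ cong (_+ ΣD) new≡ ⟩
          s ∸ 1 + w + s * c m + ΣD              ≡⟨ regroup (s ∸ 1) w (s * c m) ΣD ⟩
          (w + (s ∸ 1)) + (s * c m + ΣD)        ≤⟨ +-mono-≤ (+-monoˡ-≤ (s ∸ 1) w≤M)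
                                                     (≤-trans (+-monoˡ-≤ ΣD (m≤n+m (s * c m) (r m)))
                                                       (subst (_≤ n * (M + (s ∸ 1))) (sum-↭ (↭-map⁺ (estimate c r) C↭)) total)) ⟩
          suc n * (M + (s ∸ 1))                 ∎)
        (begin
          v x + w                      ≤⟨ +-monoˡ-≤ w (evicted x∉C ℭ≤C m∈C) ⟩
          s ∸ 1 + s * c m + w          ≡⟨ new≡′ ⟨
          new                          ∎)
        (begin
          ℭ * new                                      ≡⟨ cong (ℭ *_) new≡′ ⟩
          ℭ * (s ∸ 1 + s * c m + w)                    ≡⟨ *-distribˡ-+ ℭ _ w ⟩
          ℭ * (s ∸ 1 + s * c m) + ℭ * w                ≤⟨ +-monoˡ-≤ (ℭ * w) (minimum-bound ℭ≤C m-min) ⟩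
          n * (M + 2 * (s ∸ 1)) + ℭ * w                ≤⟨ +-mono-≤ (m≤n+m _ _) (*-monoʳ-≤ ℭ (m≤n+m w (v x))) ⟩
          suc n * (M + 2 * (s ∸ 1)) + ℭ * (v x + w)    ≡⟨ +-comm _ (ℭ * (v x + w)) ⟩
          ℭ * (v x + w) + suc n * (M + 2 * (s ∸ 1))    ∎)
        -- An eviction leaves the size unchanged, so `C` is still full.
        (λ _ <ℭ → contradiction (subst (_< ℭ) (sym |C|≡) <ℭ) (≤⇒≯ ℭ≤C))
        (λ {y} y∉ _ → ≤-trans (evicted-bound y∉ m∈C) (+-monoʳ-≤ (s ∸ 1) (*-monoʳ-≤ s (m≤m+n (c m) _)))
                    , evicted-bound y∉ ∘ ∖-⊆)
        where
        open ≤-Reasoning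
        new ΣD : ℕ
        new = (s ∸ 1 + w) % s + s * (c m + (s ∸ 1 + w) / s)
        ΣD  = sum (map (estimate c r) (C ∖ m))
        C↭ : C ↭ m ∷ C ∖ m
        C↭ = ∷-∖-↭ unique m∈C
        |C|≡ : length C ≡ suc (length (C ∖ m))
        |C|≡ = ↭-length C↭
        xD! : Unique (x ∷ C ∖ m)
        xD! with Unique-∷-∖ unique m∈C
        ... | _ ∷ D! = All.¬Any⇒All¬ _ (x∉C ∘ ∖-⊆) ∷ D!
        new≡ : new ≡ s ∸ 1 + w + s * c m
        new≡ = carry (s ∸ 1 + w) (c m)
        new≡′ : new ≡ s ∸ 1 + s * c m + w
        new≡′ = trans new≡ (xy∙z≈xz∙y (s ∸ 1) w (s * c m))
        regroup : ∀ a b k t → a + b + k + t ≡ (b + a) + (k + t)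
        regroup = solve 4 (λ a b k t → a :+ b :+ k :+ t := (b :+ a) :+ (k :+ t)) refl
          where open +-*-Solver
        -- The evicted m itself is covered because its remainder is below s.
        evicted-bound : ∀ {y z} → y ∉ x ∷ C ∖ m → z ∈ C → v y ≤ s ∸ 1 + s * c z
        evicted-bound {y} {z} y∉ z∈C with y ∈? C
        ... | no  y∉C = evicted y∉C ℭ≤C z∈C
        ... | yes y∈C with ∈-resp-↭ C↭ y∈C
        ...   | there y∈D = contradiction (there y∈D) y∉
        ...   | here refl = begin
          v m                  ≤⟨ lower m∈C ⟩
          r m + s * c m        ≤⟨ +-mono-≤ (∸-monoˡ-≤ 1 (remainder<s m∈C)) (*-monoʳ-≤ s (m-min z∈C)) ⟩
          s ∸ 1 + s * c z      ∎

  -- Whole streams and queries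

  step : ∀ {M n v σ σ′ x w} → w ≤ M → FastAdd _≟_ s ℭ σ x w σ′ →
         Invariant M n v σ → Invariant M (suc n) (update v x (v x + w)) σ′
  step w≤M (direct (inj₁ x∈C)) I = hit-step I w≤M x∈C
  step w≤M (direct {C = C} {x = x} (inj₂ C<ℭ)) I = [ hit-step I w≤M , (λ x∉C → new-step I w≤M x∉C C<ℭ) ]′ (toSum (x ∈? C))
  step w≤M (evict ¬dir m∈C m-min) I =
    evict-step I w≤M (¬dir ∘ inj₁) (≮⇒≥ (¬dir ∘ inj₂)) m∈C m-min

  -- The volume accumulated step by step agrees with `volume` only pointwise.
  Invariant-resp : ∀ {M n v v′ σ} → (∀ y → v y ≡ v′ y) → Invariant M n v σ → Invariant M n v′ σ
  Invariant-resp {M} {n} v≗v′ I = record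
    { unique      = unique
    ; size≤ℭ      = size≤ℭ
    ; size≤n      = size≤n
    ; remainder<s = remainder<s
    ; total       = total
    ; lower       = λ {y} y∈C → subst (_≤ _) (v≗v′ y) (lower y∈C)
    ; upper       = λ {y} y∈C → subst (λ t → _ ≤ ℭ * t + n * (M + 2 * (s ∸ 1))) (v≗v′ y) (upper y∈C)
    ; fresh       = λ {y} y∉C C<ℭ → let cy , ry , vy = fresh y∉C C<ℭ in cy , ry , trans (sym (v≗v′ y)) vy
    ; evicted     = λ {y} y∉C ℭ≤C z∈C → subst (_≤ _) (v≗v′ y) (evicted y∉C ℭ≤C z∈C)
    }
    where open Invariant I

  initial-invariant : ∀ M → Invariant M 0 (λ _ → 0) (Algorithm.initial (fastAlgorithm _≟_ s ℭ))
  initial-invariant M = record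
    { unique      = []
    ; size≤ℭ      = z≤n
    ; size≤n      = z≤n
    ; remainder<s = λ ()
    ; total       = z≤n
    ; lower       = λ ()
    ; upper       = λ ()
    ; fresh       = λ _ _ → refl , refl , refl
    ; evicted     = λ _ _ ()
    }

  -- Starts from any state and any past volume `v`, since the induction on the stream moves the
  -- starting point forward.
  process : ∀ {M n N v σ σ′} {ps : Stream U M N} → Process (fastAlgorithm _≟_ s ℭ) σ ps σ′ →
            Invariant M n v σ → Invariant M (n + N) (λ y → v y + volume _≟_ ps y) σ′
  process {M} {n} {v = v} {σ = σ} [] I =
    subst (λ k → Invariant M k _ σ) (sym (+-identityʳ n)) (Invariant-resp (λ y → sym (+-identityʳ (v y))) I)
  process {M} {n} {suc N} {v} {σ′ = σ′} (_∷_ {x = x} {w} {w∈} {ps} add run) I =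
    subst (λ k → Invariant M k (λ y → v y + volume _≟_ ((x , w , w∈) ∷ ps) y) σ′) (sym (+-suc n N))
      (Invariant-resp volume-∷ (process run (step (proj₂ w∈) add I)))
    where
    volume-∷ : ∀ y → update v x (v x + w) y + volume _≟_ ps y ≡ v y + volume _≟_ ((x , w , w∈) ∷ ps) y
    -- `volume` compares `x ≟ y` while `update` compares `y ≟ x`, so both decisions have to be
    -- split.
    volume-∷ y with x ≟ y | y ≟ x
    ... | yes refl | yes _   = +-assoc (v x) w _
    ... | yes refl | no x≢x  = contradiction refl x≢x
    ... | no x≢x   | yes refl = contradiction refl x≢x
    ... | no _     | no _     = refl

  minimum-≤ : ∀ ns → All (minimum _≟_ s ℭ ns ≤_) ns
  minimum-≤ []       = []
  minimum-≤ (n ∷ ns) = foldr-⊓-≤-base n ns ∷ foldr-⊓-≤ n ns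
    where
    foldr-⊓-≤-base : ∀ n ns → foldr _⊓_ n ns ≤ n
    foldr-⊓-≤-base n []       = ≤-refl
    foldr-⊓-≤-base n (k ∷ ns) = ≤-trans (m⊓n≤n k _) (foldr-⊓-≤-base n ns)
    foldr-⊓-≤ : ∀ n ns → All (foldr _⊓_ n ns ≤_) ns
    foldr-⊓-≤ n []       = []
    foldr-⊓-≤ n (k ∷ ns) = m⊓n≤m k _ ∷ All.map (≤-trans (m⊓n≤n k _)) (foldr-⊓-≤ n ns)

  minimum-∈ : ∀ {ns} → 0 < length ns → minimum _≟_ s ℭ ns ∈ ns
  minimum-∈ {n ∷ ns} _ with foldr-selective ⊓-sel n ns
  ... | inj₁ ≡n = here ≡n
  ... | inj₂ ∈ns = there ∈ns

  query-direct : ∀ {C c r x} → Direct _≟_ s ℭ C x →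
                 fastQuery _≟_ s ℭ ⟨ C , c , r ⟩ x ≡ estimate c r x
  query-direct {C} {x = x} dir =
    cong (if_then _ else _) (dec-true (direct? _≟_ s ℭ C x) dir)

  query-indirect : ∀ {C c r x} → ¬ Direct _≟_ s ℭ C x →
                   fastQuery _≟_ s ℭ ⟨ C , c , r ⟩ x ≡ s ∸ 1 + s * minimum _≟_ s ℭ (map c C)
  query-indirect {C} {x = x} ¬dir =
    cong (if_then _ else _) (dec-false (direct? _≟_ s ℭ C x) ¬dir)

  -- For an id outside a full `C`, the minimum is attained at some `z` in `C`, where `evicted` gives
  -- the lower bound; `minimum-bound` caps the returned value itself.
  query-bounds : ∀ {M n v σ} → 0 < ℭ → Invariant M n v σ → ∀ x →
    v x ≤ fastQuery _≟_ s ℭ σ x ×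
    ℭ * fastQuery _≟_ s ℭ σ x ≤ ℭ * v x + n * (M + 2 * (s ∸ 1))
  query-bounds {v = v} {σ = ⟨ C , c , r ⟩} 0<ℭ I x with toSum (direct? _≟_ s ℭ C x)
  ... | inj₁ dir rewrite query-direct {c = c} {r} dir = direct-lower I dir , direct-upper I dir
  ... | inj₂ ¬dir rewrite query-indirect {c = c} {r} ¬dir = lower′ , upper′
    where
    ℭ≤C : ℭ ≤ length C
    ℭ≤C = ≮⇒≥ (¬dir ∘ inj₂)
    lower′ : v x ≤ s ∸ 1 + s * minimum _≟_ s ℭ (map c C)
    lower′ with ∈-map⁻ c (minimum-∈ (subst (0 <_) (sym (length-map c C)) (≤-trans 0<ℭ ℭ≤C)))
    ... | z , z∈C , min≡ = subst (λ k → v x ≤ s ∸ 1 + s * k) (sym min≡)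
                             (Invariant.evicted I (¬dir ∘ inj₁) ℭ≤C z∈C)
    upper′ : ℭ * (s ∸ 1 + s * minimum _≟_ s ℭ (map c C)) ≤ ℭ * v x + _
    upper′ = m≤n⇒m≤o+n _ (minimum-bound I ℭ≤C λ y∈C → All.lookup (minimum-≤ (map c C)) (∈-map⁺ c y∈C))

-- The linked list of groups

module _ (costs : Costs) where
  open import Data.Nat.Base using (_+_; _*_)
  open Costs costs

  -- A comparison and a move for each of `k` groups passed, then a last comparison and the
  -- insertion.
  placeCost : ℕ → ℕ
  placeCost k = k * (arithmetic + groupMove) + (arithmetic + itemInsert)

  -- The elementary operations of each branch of an operation form a subsequence
  -- of this one.
  operationCost : ℕ → ℕ
  operationCost k =
    hashAccess + (arithmetic + (arithmetic + (arithmetic + (groupMove +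
    (arithmetic + (arithmetic + (arithmetic + (arithmetic + (arithmetic +
    (itemRemove + (hashAccess + (placeCost k + (arithmetic + hashAccess)))))))))))))

module _ {u : Level} {U : Set u} where
  open import Data.Nat.Base using (_+_; _*_; _≤_; _<_)
  open ℕₚ hiding (_≟_)

  itemList : Group U → List (Item U)
  itemList g = List⁺.toList (items g)

  Increasing : List (Group U) → Set u
  Increasing = AllPairs (_<_ on value)

  Contents : (c r : U → ℕ) → List (Group U) → Set u
  Contents c r = All λ g → All (λ (x , ρ) → c x ≡ value g × r x ≡ ρ) (itemList g)

  ids-++ : ∀ (gs hs : List (Group U)) → ids (gs ++ hs) ≡ ids gs ++ ids hs
  ids-++ = concatMap-++ _

  detach-ids : ∀ (g : Group U) i gs →
    ids (g ∷ gs) ↭ proj₁ (lookup (itemList g) i) ∷ ids (detach g i gs)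
  detach-ids g i gs with removeAt (itemList g) i | removeAt-↭ (itemList g) i
  ... | []     | g↭ = ↭-++⁺ʳ (ids gs) (↭-map⁺ proj₁ g↭)
  ... | j ∷ js | g↭ = ↭-++⁺ʳ (ids gs) (↭-map⁺ proj₁ g↭)

  detach-values : ∀ {p} {P : ℕ → Set p} (g : Group U) i {gs} → P (value g) →
    All (P ∘ value) gs → All (P ∘ value) (detach g i gs)
  detach-values g i Pg Pgs with removeAt (itemList g) i
  ... | []     = Pgs
  ... | j ∷ js = Pg ∷ Pgs

  detach-contents : ∀ {c r} (g : Group U) i {gs} → Contents c r (g ∷ gs) → Contents c r (detach g i gs)
  detach-contents g i (g-ok ∷ gs-ok) with removeAt (itemList g) i | All-removeAt i g-ok
  ... | []     | _    = gs-ok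
  ... | j ∷ js | j-ok = j-ok ∷ gs-ok

  detach-increasing : ∀ gs₁ (g : Group U) i {gs₂} → Increasing (gs₁ ++ g ∷ gs₂) → Increasing (gs₁ ++ detach g i gs₂)
  detach-increasing [] g i (g< ∷ inc) with removeAt (itemList g) i
  ... | []     = inc
  ... | j ∷ js = g< ∷ inc
  detach-increasing (h ∷ gs₁) g i (h< ∷ inc) with All.++⁻ gs₁ h<
  ... | h<gs₁ , h<g ∷ h<gs₂ = All.++⁺ h<gs₁ (detach-values {P = value h <_} g i h<g h<gs₂) ∷ detach-increasing gs₁ g i inc

  detach-after-ids : ∀ gs₁ (g : Group U) i gs₂ →
    ids (gs₁ ++ g ∷ gs₂) ↭ proj₁ (lookup (itemList g) i) ∷ ids (gs₁ ++ detach g i gs₂)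
  detach-after-ids gs₁ g i gs₂ = begin
    ids (gs₁ ++ g ∷ gs₂)                 ≡⟨ ids-++ gs₁ (g ∷ gs₂) ⟩
    ids gs₁ ++ ids (g ∷ gs₂)             ↭⟨ ↭-++⁺ˡ (ids gs₁) (detach-ids g i gs₂) ⟩
    ids gs₁ ++ y ∷ ids (detach g i gs₂)  ↭⟨ shift y (ids gs₁) _ ⟩
    y ∷ ids gs₁ ++ ids (detach g i gs₂)  ≡⟨ cong (y ∷_) (ids-++ gs₁ (detach g i gs₂)) ⟨
    y ∷ ids (gs₁ ++ detach g i gs₂)      ∎
    where
    open PermutationReasoning
    y : U
    y = proj₁ (lookup (itemList g) i)

  increasing-before : ∀ gs₁ {g : Group U} {gs₂} → Increasing (gs₁ ++ g ∷ gs₂) → All ((_< value g) ∘ value) gs₁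
  increasing-before []        _          = []
  increasing-before (h ∷ gs₁) (h< ∷ inc) = All.head (All.++⁻ʳ gs₁ h<) ∷ increasing-before gs₁ inc

  increasing-++⁻ʳ : ∀ gs₁ {gs₂} → Increasing (gs₁ ++ gs₂) → Increasing gs₂
  increasing-++⁻ʳ []        inc       = inc
  increasing-++⁻ʳ (_ ∷ gs₁) (_ ∷ inc) = increasing-++⁻ʳ gs₁ inc

  contents-cong : ∀ {c r c′ r′ gs} → (∀ {y} → y ∈ ids gs → c′ y ≡ c y × r′ y ≡ r y) →
    Contents c r gs → Contents c′ r′ gs
  contents-cong ≗ [] = []
  contents-cong {gs = g ∷ gs} ≗ (g-ok ∷ gs-ok) =
    All.tabulate (λ i∈g →
      let c≡ , r≡ = All.lookup g-ok i∈g
          c′≡ , r′≡ = ≗ (∈-++⁺ˡ (∈-map⁺ proj₁ i∈g))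
      in trans c′≡ c≡ , trans r′≡ r≡)
    ∷ contents-cong (≗ ∘ ∈-++⁺ʳ _) gs-ok

  contents-values : ∀ {c r} {P : ℕ → Set} {gs} → Contents c r gs → All (P ∘ value) gs →
                    ∀ {y} → y ∈ ids gs → P (c y)
  contents-values {gs = g ∷ gs} (g-ok ∷ gs-ok) (Pg ∷ Pgs) y∈ with ∈-++⁻ (map proj₁ (itemList g)) y∈
  ... | inj₂ y∈gs = contents-values gs-ok Pgs y∈gs
  contents-values {P = P} {gs = g ∷ gs} (g-ok ∷ gs-ok) (Pg ∷ Pgs) y∈ | inj₁ y∈g with ∈-map⁻ proj₁ y∈g
  ... | _ , i∈g , refl = subst P (sym (proj₁ (All.lookup g-ok i∈g))) Pg

  module _ (_≟_ : DecidableEquality U) where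

    findNode-nothing : ∀ x gs → findNode _≟_ x gs ≡ nothing → x ∉ ids gs
    findNode-nothing x (g ∷ gs) eq x∈ with any? (λ i → x ≟ proj₁ i) (itemList g)
    ... | no x∉g with findNode _≟_ x gs in eq′ | ∈-++⁻ (map proj₁ (itemList g)) x∈
    ...   | nothing | inj₂ x∈gs = findNode-nothing x gs eq′ x∈gs
    ...   | nothing | inj₁ x∈g  = x∉g (Any.map⁻ x∈g)

    findNode-just : ∀ x gs {gs₁ g i gs₂} → findNode _≟_ x gs ≡ just (node gs₁ g i gs₂) →
      gs ≡ gs₁ ++ g ∷ gs₂ × x ≡ proj₁ (lookup (itemList g) i)
    findNode-just x (g ∷ gs) eq with any? (λ i → x ≟ proj₁ i) (itemList g)
    findNode-just x (g ∷ gs) refl | yes x∈g = refl , Any.lookup-index x∈g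
    ... | no x∉g with findNode _≟_ x gs in eq′
    findNode-just x (g ∷ gs) refl | no x∉g | just (node _ _ _ _) =
      let gs≡ , x≡ = findNode-just x gs eq′ in cong (g ∷_) gs≡ , x≡

  module _ (costs : Costs) where
    open Costs costs

    -- The values met on the way are distinct and lie in [a, v).
    place-cost : ∀ {v a k} (i : Item U) gs → Increasing gs → All ((a ≤_) ∘ value) gs → v ≤ a + k →
                 cost (place costs v i gs) ≤ placeCost costs k
    place-cost {k = k} i [] _ _ _ =
      m≤n⇒m≤o+n (k * (arithmetic + groupMove)) (m≤n+m itemInsert arithmetic)
    place-cost {v} {a} {k} i (g ∷ gs) (g< ∷ inc) (a≤g ∷ _) v≤a+k with <-cmp v (value g)
    ... | tri< _ _ _ = m≤n+m _ (k * (arithmetic + groupMove))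
    ... | tri≈ _ _ _ = m≤n+m _ (k * (arithmetic + groupMove))
    ... | tri> _ _ g<v with k
    -- Here `v ≤ a ≤ value g < v`, so no group can be passed once `k` is 0.
    ...   | zero  = contradiction (≤-trans g<v (≤-trans v≤a+k (≤-trans (≤-reflexive (+-identityʳ a)) a≤g))) 1+n≰n
    -- The groups after `g` have values at least `suc a`, which leaves `k′` for the rest of the
    -- walk. The summand 0 is the free last step of `place`, which puts `g` back in front.
    ...   | suc k′ = begin
      arithmetic + (groupMove + (cost (place costs v i gs) + 0)) ≡⟨ cong (λ t → arithmetic + (groupMove + t)) (+-identityʳ _) ⟩
      arithmetic + (groupMove + cost (place costs v i gs))       ≡⟨ +-assoc arithmetic groupMove _ ⟨
      arithmetic + groupMove + cost (place costs v i gs)         ≤⟨ +-monoʳ-≤ (arithmetic + groupMove) (place-cost i gs inc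
                                                                      (All.map (≤-trans (s≤s a≤g)) g<) (subst (v ≤_) (+-suc a k′) v≤a+k)) ⟩
      arithmetic + groupMove + placeCost costs k′                ≡⟨ +-assoc (arithmetic + groupMove) _ _ ⟨
      placeCost costs (suc k′)                                   ∎
      where open ≤-Reasoning

    place-ids : ∀ v i (gs : List (Group U)) → ids (result (place costs v i gs)) ↭ proj₁ i ∷ ids gs
    place-ids v i [] = ↭-refl
    place-ids v i (g ∷ gs) with <-cmp v (value g)
    ... | tri< _ _ _ = ↭-refl
    ... | tri≈ _ _ _ = ↭-refl
    ... | tri> _ _ _ = ↭-trans (↭-++⁺ˡ (map proj₁ (itemList g)) (place-ids v i gs))
                               (shift (proj₁ i) (map proj₁ (itemList g)) (ids gs))

    place-values : ∀ {p} {P : ℕ → Set p} v (i : Item U) {gs} → P v → All (P ∘ value) gs →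
                   All (P ∘ value) (result (place costs v i gs))
    place-values v i Pv [] = Pv ∷ []
    place-values v i {g ∷ gs} Pv (Pg ∷ Pgs) with <-cmp v (value g)
    ... | tri< _ _ _ = Pv ∷ Pg ∷ Pgs
    ... | tri≈ _ _ _ = Pg ∷ Pgs
    ... | tri> _ _ _ = Pg ∷ place-values v i Pv Pgs

    place-contents : ∀ {c r v x ρ gs} → c x ≡ v → r x ≡ ρ → Contents c r gs →
                     Contents c r (result (place costs v (x , ρ) gs))
    place-contents c≡ r≡ [] = ((c≡ , r≡) ∷ []) ∷ []
    place-contents {v = v} {gs = g ∷ gs} c≡ r≡ (g-ok ∷ gs-ok) with <-cmp v (value g)
    ... | tri< _ _ _   = ((c≡ , r≡) ∷ []) ∷ g-ok ∷ gs-ok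
    ... | tri≈ _ v≡g _ = ((trans c≡ v≡g , r≡) ∷ g-ok) ∷ gs-ok
    ... | tri> _ _ _   = g-ok ∷ place-contents c≡ r≡ gs-ok

    place-increasing : ∀ v (i : Item U) {gs} → Increasing gs → Increasing (result (place costs v i gs))
    place-increasing v i [] = [] ∷ []
    place-increasing v i {g ∷ gs} (g< ∷ inc) with <-cmp v (value g)
    ... | tri< v<g _ _ = (v<g ∷ All.map (<-trans v<g) g<) ∷ g< ∷ inc
    ... | tri≈ _ _ _   = g< ∷ inc
    ... | tri> _ _ g<v = place-values {P = value g <_} v i g<v g< ∷ place-increasing v i inc

    -- An id found in the hash table is placed starting from its own group; the untouched groups
    -- `gs₁` before it must then lie below its new value.
    place-after-increasing : ∀ gs₁ v (i : Item U) {gs₂} → All ((_< v) ∘ value) gs₁ → Increasing (gs₁ ++ gs₂) →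
                             Increasing (gs₁ ++ result (place costs v i gs₂))
    place-after-increasing []        v i []          inc        = place-increasing v i inc
    place-after-increasing (h ∷ gs₁) v i (h<v ∷ <v) (h< ∷ inc) with All.++⁻ gs₁ h<
    ... | h<gs₁ , h<gs₂ =
      All.++⁺ h<gs₁ (place-values {P = value h <_} v i h<v h<gs₂) ∷ place-after-increasing gs₁ v i <v inc

-- Correctness and running time of the data structure

module Structure (costs : Costs) {u : Level} {U : Set u} (_≟_ : DecidableEquality U) (s ℭ : ℕ) .{{_ : NonZero s}} where
  open import Data.Nat.Base using (_+_; _*_; _≤_; _<_)
  open ℕₚ hiding (_≟_)
  open Costs costs
  open Fast _≟_ s ℭ

  private
    h = hashAccess
    a = arithmetic
    m = groupMove
    d = itemRemove

    -- Cost bounds are read off against `operationCost` term by term: `keep` for an operation that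
    -- the branch performs, `skip` for one that it does not.
    keep : ∀ k {x y} → x ≤ y → k + x ≤ k + y
    keep k = +-monoʳ-≤ k

    skip : ∀ k {x y} → x ≤ y → x ≤ k + y
    skip k = m≤n⇒m≤o+n k

  -- `t + w < s + B * s = suc B * s`, so adding one weight to a remainder carries at most `B` into
  -- the counter.
  quotient≤ : ∀ {t w} B → t < s → w ≤ B * s → (t + w) / s ≤ B
  quotient≤ B t<s w≤Bs = s≤s⁻¹ (m<n*o⇒m/o<n (+-mono-<-≤ t<s w≤Bs))

  s∸1<s : s ∸ 1 < s
  s∸1<s = ∸-monoʳ-< {s} (s≤s z≤n) (>-nonZero⁻¹ s)

  -- `addSOS` computes from the value of a group and a stored remainder, `FastAdd` from `c` and `r`;
  -- this bridges the two.
  represents-cong : ∀ {S C C′ c r x v v′ ρ ρ′} → C ≡ C′ → v ≡ v′ → ρ ≡ ρ′ →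
    Represents S ⟨ C , update c x v , update r x ρ ⟩ →
    Represents S ⟨ C′ , update c x v′ , update r x ρ′ ⟩
  represents-cong refl refl refl R = R

  -- The common end of all updates: `x` is placed among groups that do not contain it. The skipped
  -- prefix `gs₁` is empty unless `x` was found in the hash table.
  represents-place : ∀ {c r x v ρ C′ k} gs₁ {gs₂} → Increasing (gs₁ ++ gs₂) → All ((_< v) ∘ value) gs₁ →
    x ∉ ids (gs₁ ++ gs₂) → Contents c r (gs₁ ++ gs₂) → x ∷ ids (gs₁ ++ gs₂) ↭ C′ → k ≡ length C′ →
    Represents (sos k (gs₁ ++ result (place costs v (x , ρ) gs₂))) ⟨ C′ , update c x v , update r x ρ ⟩
  represents-place {c} {r} {x} {v} {ρ} {C′} gs₁ {gs₂} inc <v x∉ ok xgs↭C′ k≡ = record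
    { size-C     = k≡
    ; ids-C      = begin
        ids (gs₁ ++ gs₂′)          ≡⟨ ids-++ gs₁ gs₂′ ⟩
        ids gs₁ ++ ids gs₂′        ↭⟨ ↭-++⁺ˡ (ids gs₁) (place-ids costs v (x , ρ) gs₂) ⟩
        ids gs₁ ++ x ∷ ids gs₂     ↭⟨ shift x (ids gs₁) (ids gs₂) ⟩
        x ∷ ids gs₁ ++ ids gs₂     ≡⟨ cong (x ∷_) (ids-++ gs₁ gs₂) ⟨
        x ∷ ids (gs₁ ++ gs₂)       ↭⟨ xgs↭C′ ⟩
        C′                         ∎
    ; increasing = AllPairs⇒Linked (place-after-increasing costs gs₁ v (x , ρ) <v inc)
    ; contents   = All.++⁺ (All.++⁻ˡ gs₁ ok′)
                     (place-contents costs (update-same c x v) (update-same r x ρ) (All.++⁻ʳ gs₁ ok′))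
    }
    where
    open PermutationReasoning
    gs₂′ : List (Group U)
    gs₂′ = result (place costs v (x , ρ) gs₂)
    ok′ : Contents (update c x v) (update r x ρ) (gs₁ ++ gs₂)
    ok′ = contents-cong (λ y∈ → update-other c v (≢x y∈) , update-other r ρ (≢x y∈)) ok
      where
      ≢x : ∀ {y} → y ∈ ids (gs₁ ++ gs₂) → y ≢ x
      ≢x y∈ refl = x∉ y∈

  module _ {M : ℕ} (B : ℕ) {n : ℕ} {v : U → ℕ} {σ : FastState U} (0<ℭ : 0 < ℭ) (M≤Bs : M ≤ B * s)
           (I : Invariant M n v σ) {S : SOS U} (R : Represents S σ) where
    open FastState σ
    open Invariant I
    open Represents R

    inc : Increasing (groups S)
    inc = Linked⇒AllPairs <-trans increasing

    ids! : Unique (ids (groups S))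
    ids! = Unique-resp-↭ (↭-sym ids-C) unique

    ℭ≤size⇒groups : ¬ (size S < ℭ) → groups S ≢ []
    ℭ≤size⇒groups size≮ℭ gs≡[] = size≮ℭ (subst (_< ℭ) (sym size≡0) 0<ℭ)
      where
      size≡0 : size S ≡ 0
      size≡0 = trans size-C (sym (↭-length (subst (λ gs → ids gs ↭ C) gs≡[] ids-C)))

    ¬direct : ∀ {x} → x ∉ ids (groups S) → ¬ (size S < ℭ) → ¬ Direct _≟_ s ℭ C x
    ¬direct x∉ _      (inj₁ x∈C) = x∉ (∈-resp-↭ (↭-sym ids-C) x∈C)
    ¬direct _  size≮ℭ (inj₂ C<ℭ) = size≮ℭ (subst (_< ℭ) (sym size-C) C<ℭ)

    module Found {x : U} {gs₁ : List (Group U)} {g : Group U} {i : Fin (List⁺.length (items g))}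
                 {gs₂ : List (Group U)} (found : findNode _≟_ x (groups S) ≡ just (node gs₁ g i gs₂)) where
      gs≡ : groups S ≡ gs₁ ++ g ∷ gs₂
      gs≡ = proj₁ (findNode-just _≟_ x (groups S) found)

      ρ : ℕ
      ρ = proj₂ (lookup (itemList g) i)

      inc′ : Increasing (gs₁ ++ g ∷ gs₂)
      inc′ = subst Increasing gs≡ inc

      ok′ : Contents c r (gs₁ ++ g ∷ gs₂)
      ok′ = subst (Contents c r) gs≡ contents

      entry : c x ≡ value g × r x ≡ ρ
      entry = subst (λ y → c y ≡ value g × r y ≡ ρ) (sym (proj₂ (findNode-just _≟_ x (groups S) found)))
        (All.lookup (All.head (All.++⁻ʳ gs₁ ok′)) (∈-lookup {xs = itemList g} i))

      ids↭ : ids (groups S) ↭ x ∷ ids (gs₁ ++ detach g i gs₂)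
      ids↭ = subst₂ (λ gs y → ids gs ↭ y ∷ ids (gs₁ ++ detach g i gs₂)) (sym gs≡)
        (sym (proj₂ (findNode-just _≟_ x (groups S) found))) (detach-after-ids gs₁ g i gs₂)

      x∈C : x ∈ C
      x∈C = ∈-resp-↭ ids-C (∈-resp-↭ (↭-sym ids↭) (here refl))

    module First {g : Group U} {gs : List (Group U)} (gs≡ : groups S ≡ g ∷ gs) where
      inc′ : Increasing (g ∷ gs)
      inc′ = subst Increasing gs≡ inc

      ok′ : Contents c r (g ∷ gs)
      ok′ = subst (Contents c r) gs≡ contents

      ids↭ : ids (g ∷ gs) ↭ C
      ids↭ = subst (λ hs → ids hs ↭ C) gs≡ ids-C

      -- Values increase along the list, so the first group holds the least counters and any of its
      -- items may be evicted.
      value-min : ∀ {y} → y ∈ C → value g ≤ c y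
      value-min y∈C = contents-values {P = value g ≤_} ok′ (≤-refl ∷ All.map <⇒≤ (AllPairs.head inc′))
        (∈-resp-↭ (↭-sym ids↭) y∈C)

      module _ (i : Fin (length (itemList g))) where
        member : U
        member = proj₁ (lookup (itemList g) i)

        member∈C : member ∈ C
        member∈C = ∈-resp-↭ ids↭ (∈-++⁺ˡ (∈-map⁺ proj₁ (∈-lookup {xs = itemList g} i)))

        c-member : c member ≡ value g
        c-member = proj₁ (All.lookup (All.head ok′) (∈-lookup {xs = itemList g} i))

    AddCorrect : U → ℕ → Timed (SOS U) → Set u
    AddCorrect x w t = cost t ≤ operationCost costs B × (∃ λ σ′ → FastAdd _≟_ s ℭ σ x w σ′ × Represents (result t) σ′)

    add-correct : ∀ pick x {w} → w ≤ M → AddCorrect x w (addSOS costs _≟_ s ℭ pick S x w)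
    add-correct pick x {w} w≤M with findNode _≟_ x (groups S) in found
    ... | just (node gs₁ g i gs₂) =
        (keep h $ keep a $ keep a $ keep a $ skip m $ keep a $ skip a $ skip a $ skip a $ skip a $ keep d $ skip h $
          +-mono-≤ (place-cost costs _ _ (detach-increasing [] g i (increasing-++⁻ʳ gs₁ inc′))
                     (detach-values {P = value g ≤_} g i ≤-refl (All.map <⇒≤ (AllPairs.head (increasing-++⁻ʳ gs₁ inc′))))
                     (+-monoʳ-≤ (value g) (quotient≤ B (subst (_< s) rx≡ρ (remainder<s x∈C)) (≤-trans w≤M M≤Bs))))
                   (skip a ≤-refl))
      , _ , direct (inj₁ x∈C)
      , represents-cong (sym (∪-∈ x∈C)) (cong₂ (λ k ρ → k + (ρ + w) / s) (sym cx≡) (sym rx≡ρ))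
          (cong (λ ρ → (ρ + w) % s) (sym rx≡ρ))
          (represents-place gs₁ (detach-increasing gs₁ g i inc′)
            (All.map (λ <g → <-≤-trans <g (m≤m+n (value g) _)) (increasing-before gs₁ inc′))
            (Unique[x∷xs]⇒x∉xs (Unique-resp-↭ ids↭ ids!))
            (All.++⁺ (All.++⁻ˡ gs₁ ok′) (detach-contents g i (All.++⁻ʳ gs₁ ok′)))
            (↭-trans (↭-sym ids↭) ids-C) size-C)
      where
      open Found found
      cx≡  = proj₁ entry
      rx≡ρ = proj₂ entry
    ... | nothing with size S <? ℭ
    ...   | yes size<ℭ =
        (keep h $ keep a $ keep a $ keep a $ keep m $ skip a $ skip a $ skip a $ skip a $ skip a $ skip d $ skip h $
          -- A new id starts from counter and remainder 0, so its value `w / s` is at most `B` and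
          -- the walk can begin at the first group.
          +-mono-≤ (place-cost costs {a = 0} _ _ inc (All.universal (λ _ → z≤n) _) (quotient≤ B (>-nonZero⁻¹ s) (≤-trans w≤M M≤Bs))) ≤-refl)
      , _ , direct (inj₂ C<ℭ)
      , represents-cong (sym (∪-∉ x∉C)) (cong₂ (λ k ρ → k + (ρ + w) / s) (sym cx≡0) (sym rx≡0))
          (cong (λ ρ → (ρ + w) % s) (sym rx≡0))
          (represents-place [] inc [] x∉ contents (↭-prep x ids-C) (cong suc size-C))
      where
      x∉ : x ∉ ids (groups S)
      x∉ = findNode-nothing _≟_ x (groups S) found
      x∉C : x ∉ C
      x∉C = x∉ ∘ ∈-resp-↭ (↭-sym ids-C)
      C<ℭ : length C < ℭ
      C<ℭ = subst (_< ℭ) size-C size<ℭ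
      cx≡0 = proj₁ (fresh x∉C C<ℭ)
      rx≡0 = proj₁ (proj₂ (fresh x∉C C<ℭ))
    ...   | no  size≮ℭ with groups S in gs≡
    ...     | []     = contradiction gs≡ (ℭ≤size⇒groups size≮ℭ)
    ...     | g ∷ gs =
        (keep h $ keep a $ skip a $ skip a $ keep m $ keep a $ keep a $ keep a $ keep a $ keep a $ keep d $ keep h $
          +-mono-≤ (place-cost costs _ _ inc″
                     (detach-values {P = value g ≤_} g i ≤-refl (All.map <⇒≤ (AllPairs.head inc′)))
                     (+-monoʳ-≤ (value g) (quotient≤ B s∸1<s (≤-trans w≤M M≤Bs))))
                   (skip a ≤-refl))
      , _ , evict x-indirect m∈C (λ y∈C → subst (_≤ _) (sym cm≡) (value-min y∈C))
      , represents-cong (sym (∪-∉ (x∉C ∘ ∖-⊆))) (cong (_+ (s ∸ 1 + w) / s) (sym cm≡)) refl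
          (represents-place [] inc″ [] (x∉C ∘ ∖-⊆ ∘ ∈-resp-↭ rest↭) (detach-contents g i ok′)
            (↭-prep x rest↭) (trans size-C (↭-length (∷-∖-↭ unique m∈C))))
      where
      open First gs≡
      i    = pick (items g)
      y    = member i
      m∈C  = member∈C i
      cm≡  = c-member i
      inc″ = detach-increasing [] g i inc′
      x-indirect = ¬direct (findNode-nothing _≟_ x (groups S) (trans (cong (findNode _≟_ x) gs≡) found)) size≮ℭ
      x∉C  = x-indirect ∘ inj₁
      rest↭ : ids (detach g i gs) ↭ C ∖ y
      rest↭ = drop-∷ (↭-trans (↭-sym (detach-ids g i gs)) (↭-trans ids↭ (∷-∖-↭ unique m∈C)))

    query-correct : ∀ x →
      let t = querySOS costs _≟_ s ℭ S x in
      cost t ≤ operationCost costs B × result t ≡ fastQuery _≟_ s ℭ σ x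
    query-correct x with findNode _≟_ x (groups S) in found
    ... | just (node gs₁ g i gs₂) =
        (keep h $ keep a $ m≤m+n a _)
      , trans (cong₂ (λ ρ k → ρ + s * k) (sym (proj₂ entry)) (sym (proj₁ entry))) (sym (query-direct {c = c} {r} (inj₁ x∈C)))
      where open Found found
    ... | nothing with size S <? ℭ
    ...   | yes size<ℭ =
        (keep h $ keep a $ z≤n)
      , trans (sym (trans (cong₂ (λ ρ k → ρ + s * k) rx≡0 cx≡0) (*-zeroʳ s))) (sym (query-direct {C} {c} {r} (inj₂ C<ℭ)))
      where
      C<ℭ : length C < ℭ
      C<ℭ = subst (_< ℭ) size-C size<ℭ
      x-fresh = fresh (findNode-nothing _≟_ x (groups S) found ∘ ∈-resp-↭ (↭-sym ids-C)) C<ℭ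
      cx≡0 = proj₁ x-fresh
      rx≡0 = proj₁ (proj₂ x-fresh)
    ...   | no  size≮ℭ with groups S in gs≡
    ...     | []     = contradiction gs≡ (ℭ≤size⇒groups size≮ℭ)
    ...     | g ∷ gs =
        (keep h $ keep a $ skip a $ skip a $ keep m $ keep a $ keep a $ m≤m+n a _)
      , trans (cong (λ k → s ∸ 1 + s * k) value≡minimum)
          (sym (query-indirect {c = c} {r} (¬direct (findNode-nothing _≟_ x (groups S) (trans (cong (findNode _≟_ x) gs≡) found)) size≮ℭ)))
      where
      open First gs≡
      -- The value of the first group is below every counter, and it is attained by the first item
      -- of that group.
      value≡minimum : value g ≡ minimum _≟_ s ℭ (map c C)
      value≡minimum = ≤-antisym
        (All.lookup {P = value g ≤_} (All.map⁺ (All.tabulate value-min)) (minimum-∈ (subst (0 <_) (sym (length-map c C)) 0<C)))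
        (subst (_ ≤_) (c-member zero) (All.lookup (minimum-≤ (map c C)) (∈-map⁺ c (member∈C zero))))
        where
        0<C : 0 < length C
        0<C = ≤-trans 0<ℭ (≮⇒≥ (size≮ℭ ∘ subst (_< ℭ) (sym size-C)))

  empty-represents : Represents emptySOS (Algorithm.initial (fastAlgorithm _≟_ s ℭ))
  empty-represents = record { size-C = refl ; ids-C = ↭-refl ; increasing = [] ; contents = [] }

  module _ {M : ℕ} (B : ℕ) (0<ℭ : 0 < ℭ) (M≤Bs : M ≤ B * s) where

    runsInTime : RunsInTime costs _≟_ s ℭ M (operationCost costs B)
    runsInTime = empty-represents , λ ps run R →
      let I = process run (initial-invariant M) in
        (λ pick x (w , _ , w≤M) → add-correct B 0<ℭ M≤Bs I R pick x w≤M)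
      , query-correct B 0<ℭ M≤Bs I R

    -- Runs exist because the data structure never gets stuck: each of its updates exhibits a step
    -- of the algorithm. Evicting the first item of the first group is one admissible choice.
    process-total : ∀ {n v σ S N} (ps : Stream U M N) → Invariant M n v σ → Represents S σ →
                    ∃ λ σ′ → Process (fastAlgorithm _≟_ s ℭ) σ ps σ′
    process-total []                  I R = _ , []
    process-total ((x , w , w∈) ∷ ps) I R =
      let _ , _ , add , R′ = add-correct B 0<ℭ M≤Bs I R (λ { (_ ∷ _) → zero }) x (proj₂ w∈)
          _ , run          = process-total ps (step (proj₂ w∈) add I) R′
      in _ , add ∷ run

-- Combining the time bound with the error bound

theorem2 : ∀ {c ℓ₁ ℓ₂ u} (F : ArchimedeanOrderedField c ℓ₁ ℓ₂) →
    let open ArchimedeanOrderedField F in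
    (costs : Costs) (φ : Carrier) (0<φ : 0# < φ) →
    ∃ λ (K : ℕ) →
    ∀ {U : Set u} (_≟_ : DecidableEquality U) (ε : Carrier) → 0# < ε →
    ∀ (M : ℕ) .{{_ : NonZero M}} →
    FASTRunsInTime F costs _≟_ M ε φ 0<φ K ×
    SolvesVolumeEstimation F _≟_ ε M (FAST F _≟_ M ε φ 0<φ)
theorem2 F costs φ 0<φ = operationCost costs B , λ _≟_ ε 0<ε M →
  let open Fast _≟_ (stepSize F M φ) (counters F ε φ) {{stepSize-nonZero F M 0<φ}}
      open Structure costs _≟_ (stepSize F M φ) (counters F ε φ) {{stepSize-nonZero F M 0<φ}}
      0<ℭ  = counters-positive 0<φ 0<ε
      M≤Bs = maxWeight≤ M 0<φ
  in
    runsInTime B 0<ℭ M≤Bs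
  , λ {N} ps →
      process-total B 0<ℭ M≤Bs ps (initial-invariant M) empty-represents
    , λ run x →
        let lower , upper = query-bounds 0<ℭ (process run (initial-invariant M)) x
        in lower , scaled-error-bound M 0<φ N 0<ε upper
  where
  open ArchimedeanOrderedField F
  open Scalars F
  -- Only `φ` enters `B`, so `operationCost costs B` serves every `M` and `ε` at once.
  B : ℕ
  B = ℤ.∣ ⌈ fromℕ 2 ÷ φ ⌉ ∣
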